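{- Let $s\ge 3$ and let $\kappa_s$ be the partition with $\beta(\kappa_s)=T_s$. Then $\kappa_s$ is an $(s,s+1,s+2)$-core partition of maximum size. If $s$ is even, $\kappa_s$ is the unique $(s,s+1,s+2)$-core partition of maximum size, and it is self-conjugate. If $s$ is odd, then $\kappa_s\ne\kappa_s'$ and $\kappa_s,\kappa_s'$ are exactly the two $(s,s+1,s+2)$-core partitions of maximum size, where $\kappa_s'$ denotes the conjugate partition.
   Context: An $(s,s+1,s+2)$-core is a partition with no hook length divisible by $s$, $s+1$ or $s+2$. The $\beta$-set $\beta(\lambda)$ is the set of hook lengths of the first-column boxes of $\lambda$; a partition is determined by its $\beta$-set. $T_s$ is the set of positive integers not expressible as $k_1s+k_2(s+1)+k_3(s+2)$ with $k_1,k_2,k_3$ nonnegative integers. -}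

module Defs where

open import Data.List.Base using (List; []; _∷_; length; filter; sum; applyUpTo)
open import Data.List.Properties using (filter-accept; filter-reject; filter-some)
open import Data.List.Relation.Unary.All using (All)
open import Data.List.Relation.Unary.Any using (here)
open import Data.List.Relation.Unary.Linked using (Linked)
import Data.List.Relation.Unary.All.Properties as All
import Data.List.Relation.Unary.Linked.Properties as Linked
open import Data.Nat.Base using (ℕ; zero; suc; _+_; _*_; _∸_; _≤_; _<_; _≥_; z≤n; s≤s)
open import Data.Nat.Divisibility using (_∤_)
open import Data.Nat.Properties using (_<?_; ≤-trans; n≤1+n; m≤n⇒m≤1+n)
open import Data.Product.Base using (∃-syntax; _×_)
open import Relation.Binary.PropositionalEquality.Core using (_≡_)
open import Relation.Nullary.Decidable.Core using (yes; no)
open import Relation.Nullary.Negation.Core using (¬_; contradiction)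
open import Relation.Unary using (Pred)
open import Level using (0ℓ)

record Partition : Set where
  constructor mkPartition
  field
    parts      : List ℕ
    positive   : All (0 <_) parts
    decreasing : Linked _≥_ parts

open Partition public

size : Partition → ℕ
size p = sum (parts p)

-- Rows and columns are numbered from 0; rows past the last one have length 0.
nth : List ℕ → ℕ → ℕ
nth []       _       = 0
nth (x ∷ _)  zero    = x
nth (_ ∷ xs) (suc i) = nth xs i

countAbove : ℕ → List ℕ → ℕ
countAbove j xs = length (filter (j <?_) xs)

row : Partition → ℕ → ℕ
row p i = nth (parts p) i

column : Partition → ℕ → ℕ
column p j = countAbove j (parts p)

countAbove-anti : ∀ j xs → countAbove (suc j) xs ≤ countAbove j xs
countAbove-anti j [] = z≤n
countAbove-anti j (x ∷ xs) with suc j <? x | j <? x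
... | yes p | yes q rewrite filter-accept (suc j <?_) {xs = xs} p | filter-accept (j <?_) {xs = xs} q
  = s≤s (countAbove-anti j xs)
... | yes p | no ¬q = contradiction (≤-trans (n≤1+n (suc j)) p) ¬q
... | no ¬p | yes q rewrite filter-reject (suc j <?_) {xs = xs} ¬p | filter-accept (j <?_) {xs = xs} q
  = m≤n⇒m≤1+n (countAbove-anti j xs)
... | no ¬p | no ¬q rewrite filter-reject (suc j <?_) {xs = xs} ¬p | filter-reject (j <?_) {xs = xs} ¬q
  = countAbove-anti j xs

countAbove-positive : ∀ {j} xs → j < nth xs 0 → 0 < countAbove j xs
countAbove-positive {j} (x ∷ xs) j<x = filter-some (j <?_) (here j<x)

conjugate : Partition → Partition
conjugate p = record
  { parts      = applyUpTo (column p) (row p 0)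
  ; positive   = All.applyUpTo⁺₁ (column p) (row p 0) (countAbove-positive (parts p))
  ; decreasing = Linked.applyUpTo⁺₂ (column p) (row p 0) (λ j → countAbove-anti j (parts p))
  }

Box : Partition → ℕ → ℕ → Set
Box p i j = j < row p i

-- Arm, plus leg, plus the box itself; only meaningful when Box p i j holds,
-- in which case neither subtraction truncates.
hook : Partition → ℕ → ℕ → ℕ
hook p i j = suc ((row p i ∸ suc j) + (column p j ∸ suc i))

β : Partition → Pred ℕ 0ℓ
β p n = ∃[ i ] (Box p i 0 × hook p i 0 ≡ n)

IsCore : ℕ → Partition → Set
IsCore t p = ∀ i j → Box p i j → t ∤ hook p i j

IsTripleCore : ℕ → Partition → Set
IsTripleCore s p = IsCore s p × IsCore (s + 1) p × IsCore (s + 2) p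

IsMaxTripleCore : ℕ → Partition → Set
IsMaxTripleCore s p =
  IsTripleCore s p × (∀ q → IsTripleCore s q → size q ≤ size p)

T : ℕ → Pred ℕ 0ℓ
T s n = 0 < n ×
  ¬ (∃[ k₁ ] ∃[ k₂ ] ∃[ k₃ ] (n ≡ k₁ * s + k₂ * (s + 1) + k₃ * (s + 2)))

{-# OPTIONS --safe #-}
-- Let s = S + 1. The β-sets of (s, s+1, s+2)-cores are the order ideals of T = T_s, and T consists of
-- the rows { k (s+2) + j : 1 ≤ j ≤ S - 2k }. For such an ideal X let Y = T \ X, let r k be the number of
-- elements of Y in row k, R = |Y| and c = |T|. Then
--   size κ - size p = ∑Y - c R + R (R + 1) / 2,
-- and pushing each row of Y to the left can only lower ∑Y. After this, the ideal property says that the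
-- elements of Y in column j are those of a final segment q, ..., e - 1 of the rows meeting that column,
-- with q weakly increasing in j. Adding the columns of Y one at a time, column j, with n = e - q
-- elements, contributes at least n ((j - ρ) (n + 1) + 2 q (e + 1)) / 2, where ρ ∈ {0, 1} is the parity of
-- s + 1 - j. This is positive unless n = 0, or s is odd, j = 1 and q = 0. Hence the only maximal cores
-- have Y empty or, for odd s, Y equal to the whole first column. Conjugation preserves cores and sizes,
-- and for odd s it moves κ, as a self-conjugate κ would have 2c - 1 in its β-set.
module Submission where

open import Defs
open import Data.List.Base using (List; []; _∷_; length; map; filter; applyUpTo; downFrom)
open import Data.List.Membership.Propositional using (_∈_; _∉_)
open import Data.List.Membership.Propositional.Properties using (∈-filter⁺; ∈-filter⁻; ∈-downFrom⁺)
open import Data.List.Properties using (filter-accept; filter-reject; length-filter; map-id; ∷-injectiveˡ; ∷-injectiveʳ)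
open import Data.List.Relation.Unary.All as All using (All; []; _∷_)
open import Data.List.Relation.Unary.AllPairs using (AllPairs; []; _∷_)
import Data.List.Relation.Unary.AllPairs.Properties as AllPairs
open import Data.List.Relation.Unary.Any using (here; there)
open import Data.List.Relation.Unary.Linked as Linked using (Linked)
import Data.List.Relation.Unary.Linked.Properties as Linked
open import Data.Nat.Base
open import Data.Nat.Divisibility using (_∣_; _∤_; divides; ∣-refl)
open import Data.Nat.DivMod using (_/_; _%_; m≡m%n+[m/n]*n; m%n<n)
open import Data.Nat.ListAction using (sum)
open import Data.Nat.Properties
open import Data.Nat.Tactic.RingSolver using (solve-∀)
open import Data.Product using (_×_; _,_; ∃-syntax; ∃!; proj₁; proj₂)
open import Data.Sum.Base as Sum using (_⊎_; inj₁; inj₂; [_,_]′)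
open import Function.Bundles using (_⇔_; mk⇔)
open import Relation.Binary.Definitions using (tri<; tri≈; tri>)
open import Relation.Binary.PropositionalEquality
open import Relation.Nullary using (¬_; Dec; yes; no)
open import Relation.Nullary.Negation using (contradiction)
open import Relation.Unary using (_≐_)

-- Finite sums

∑ : ℕ → (ℕ → ℕ) → ℕ
∑ n f = sum (applyUpTo f n)

∑-cong : ∀ n {f g : ℕ → ℕ} → (∀ i → i < n → f i ≡ g i) → ∑ n f ≡ ∑ n g
∑-cong zero    eq = refl
∑-cong (suc n) eq = cong₂ _+_ (eq 0 z<s) (∑-cong n (λ i i<n → eq (suc i) (s<s i<n)))

∑-mono : ∀ n {f g : ℕ → ℕ} → (∀ i → i < n → f i ≤ g i) → ∑ n f ≤ ∑ n g
∑-mono zero    le = z≤n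
∑-mono (suc n) le = +-mono-≤ (le 0 z<s) (∑-mono n (λ i i<n → le (suc i) (s<s i<n)))

∑-+ : ∀ n (f g : ℕ → ℕ) → ∑ n (λ i → f i + g i) ≡ ∑ n f + ∑ n g
∑-+ zero    f g = refl
∑-+ (suc n) f g = trans (cong (f 0 + g 0 +_) (∑-+ n (λ i → f (suc i)) (λ i → g (suc i))))
  (lemma (f 0) (g 0) (∑ n (λ i → f (suc i))) (∑ n (λ i → g (suc i))))
  where
  lemma : ∀ a b c d → a + b + (c + d) ≡ a + c + (b + d)
  lemma = solve-∀

∑-* : ∀ n c (f : ℕ → ℕ) → ∑ n (λ i → c * f i) ≡ c * ∑ n f
∑-* zero    c f = sym (*-zeroʳ c)
∑-* (suc n) c f = trans (cong (c * f 0 +_) (∑-* n c (λ i → f (suc i))))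
  (sym (*-distribˡ-+ c (f 0) (∑ n (λ i → f (suc i)))))

∑-split : ∀ m n (f : ℕ → ℕ) → ∑ (m + n) f ≡ ∑ m f + ∑ n (λ i → f (m + i))
∑-split zero    n f = refl
∑-split (suc m) n f = trans (cong (f 0 +_) (∑-split m n (λ i → f (suc i))))
  (sym (+-assoc (f 0) _ _))

∑-last : ∀ n (f : ℕ → ℕ) → ∑ (suc n) f ≡ ∑ n f + f n
∑-last zero    f = +-identityʳ (f 0)
∑-last (suc n) f = trans (cong (f 0 +_) (∑-last n (λ i → f (suc i)))) (sym (+-assoc (f 0) _ _))

∑-zero : ∀ n {f : ℕ → ℕ} → (∀ i → i < n → f i ≡ 0) → ∑ n f ≡ 0
∑-zero zero    eq = refl
∑-zero (suc n) eq = cong₂ _+_ (eq 0 z<s) (∑-zero n (λ i i<n → eq (suc i) (s<s i<n)))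

∑≡0⇒≡0 : ∀ n {f : ℕ → ℕ} → ∑ n f ≡ 0 → ∀ i → i < n → f i ≡ 0
∑≡0⇒≡0 (suc n) {f} eq zero    _         = m+n≡0⇒m≡0 (f 0) eq
∑≡0⇒≡0 (suc n) {f} eq (suc i) (s≤s i<n) = ∑≡0⇒≡0 n (m+n≡0⇒n≡0 (f 0) eq) i i<n

∑-const : ∀ n → ∑ n (λ _ → 1) ≡ n
∑-const zero    = refl
∑-const (suc n) = cong suc (∑-const n)

∑-rows : ∀ m w (f : ℕ → ℕ) → ∑ (m * w) f ≡ ∑ m (λ k → ∑ w (λ i → f (k * w + i)))
∑-rows zero    w f = refl
∑-rows (suc m) w f = trans (∑-split w (m * w) f) (cong (∑ w f +_)
  (trans (∑-rows m w (λ i → f (w + i)))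
    (∑-cong m (λ k _ → ∑-cong w (λ i _ → cong f (sym (+-assoc w (k * w) i)))))))

∑-mono-tight : ∀ n {f g : ℕ → ℕ} → (∀ i → i < n → f i ≤ g i) → ∑ n g ≤ ∑ n f →
  ∀ i → i < n → f i ≡ g i
∑-mono-tight (suc n) {f} {g} le ge zero _ = ≤-antisym (le 0 z<s)
  (+-cancelʳ-≤ (∑ n (λ i → f (suc i))) (g 0) (f 0)
    (≤-trans (+-monoʳ-≤ (g 0) (∑-mono n (λ i i<n → le (suc i) (s<s i<n)))) ge))
∑-mono-tight (suc n) {f} {g} le ge (suc i) (s≤s i<n) =
  ∑-mono-tight n (λ i i<n → le (suc i) (s<s i<n))
    (+-cancelˡ-≤ (f 0) _ _ (≤-trans (+-monoˡ-≤ _ (le 0 z<s)) ge)) i i<n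

-- The triangular number n (n - 1) / 2, by recursion so that no division occurs. The R (R + 1) / 2
-- of the overview is `choose₂ (suc R)`.
choose₂ : ℕ → ℕ
choose₂ zero    = 0
choose₂ (suc n) = n + choose₂ n

choose₂-+ : ∀ m n → choose₂ (m + n) ≡ choose₂ m + m * n + choose₂ n
choose₂-+ zero    n = refl
choose₂-+ (suc m) n = trans (cong (m + n +_) (choose₂-+ m n))
  (lemma m n (choose₂ m) (choose₂ n))
  where
  lemma : ∀ m n a b → m + n + (a + m * n + b) ≡ m + a + (n + m * n) + b
  lemma = solve-∀

2*choose₂-suc : ∀ n → 2 * choose₂ (suc n) ≡ n * suc n
2*choose₂-suc zero    = refl
2*choose₂-suc (suc n) = trans (lemma n (choose₂ (suc n)))
  (trans (cong (λ x → 2 * suc n + x) (2*choose₂-suc n)) (lemma′ n))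
  where
  lemma : ∀ n x → 2 * (suc n + x) ≡ 2 * suc n + 2 * x
  lemma = solve-∀
  lemma′ : ∀ n → 2 * suc n + n * suc n ≡ suc n * suc (suc n)
  lemma′ = solve-∀

-- The indices i with y i = 1 are distinct, so they add up to at least 0 + 1 + 2 + ... .
choose₂≤weighted-∑ : ∀ n (y : ℕ → ℕ) → (∀ i → i < n → y i ≤ 1) →
  ∑ n y ≤ n × choose₂ (∑ n y) ≤ ∑ n (λ i → y i * i)
choose₂≤weighted-∑ zero    y y≤1 = z≤n , z≤n
choose₂≤weighted-∑ (suc n) y y≤1
  rewrite ∑-last n y | ∑-last n (λ i → y i * i)
  with choose₂≤weighted-∑ n y (λ i i<n → y≤1 i (m<n⇒m<1+n i<n)) | y n | y≤1 n ≤-refl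
... | R≤n , le | zero  | _ rewrite +-identityʳ (∑ n y) | +-identityʳ (∑ n (λ i → y i * i)) =
  m≤n⇒m≤1+n R≤n , le
... | R≤n , le | suc zero | _ rewrite +-comm (∑ n y) 1 | +-identityʳ n =
  s≤s R≤n , ≤-trans (+-mono-≤ R≤n le) (≤-reflexive (+-comm n _))
... | _ | suc (suc _) | s≤s ()

-- In the application f marks the members of one row and g those of the row before it. A nonempty
-- set A satisfies |A + {0, 1, 2}| ≥ |A| + 2: its first member supplies three positions, and each
-- later member i supplies the new position i + 2.
dilation : ∀ n (f g : ℕ → ℕ) → (∀ i → i < n → f i ≤ 1) →
  (∀ i → i < n → 1 ≤ f i → 1 ≤ g i × 1 ≤ g (1 + i) × 1 ≤ g (2 + i)) →
  ∑ n f ≡ 0 ⊎ 2 + ∑ n f ≤ ∑ (2 + n) g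
dilation zero    f g f≤1 imp = inj₁ refl
dilation (suc n) f g f≤1 imp
  rewrite ∑-last n f | ∑-last (2 + n) g
  with dilation n f g (λ i i<n → f≤1 i (m<n⇒m<1+n i<n)) (λ i i<n → imp i (m<n⇒m<1+n i<n))
     | f n | f≤1 n ≤-refl | imp n ≤-refl
... | inj₁ eq | zero  | _ | _ rewrite eq = inj₁ refl
... | inj₂ le | zero  | _ | _ rewrite +-identityʳ (∑ n f) = inj₂ (m≤n⇒m≤n+o (g (2 + n)) le)
... | inj₁ eq | suc zero | _ | h rewrite eq | ∑-last (suc n) g | ∑-last n g with h ≤-refl
...   | g₀ , g₁ , g₂ = inj₂ (+-mono-≤ (+-mono-≤ (m≤n⇒m≤o+n (∑ n g) g₀) g₁) g₂)
dilation (suc n) f g f≤1 imp | inj₂ le | suc zero | _ | h with h ≤-refl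
...   | _ , _ , g₂ = inj₂ (+-mono-≤ le g₂)
dilation (suc n) f g f≤1 imp | _ | suc (suc _) | s≤s () | _

-- Staircases

-- half M = ⌈ M / 2 ⌉, and evenness M = 1 exactly when M is even.
half evenness : ℕ → ℕ
half zero    = 0
half (suc M) = half M + evenness M
evenness zero    = 1
evenness (suc M) = 1 ∸ evenness M

evenness-cases : ∀ M → evenness M ≡ 0 ⊎ evenness M ≡ 1
evenness-cases zero = inj₂ refl
evenness-cases (suc M) with evenness M | evenness-cases M
... | _ | inj₁ refl = inj₂ refl
... | _ | inj₂ refl = inj₁ refl

evenness+ : ∀ M → evenness M + evenness (suc M) ≡ 1
evenness+ M with evenness M | evenness-cases M
... | _ | inj₁ refl = refl
... | _ | inj₂ refl = refl

2*half : ∀ M → 2 * half M + evenness M ≡ suc M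
2*half zero    = refl
2*half (suc M) = trans (lemma (half M) (evenness M) (evenness (suc M)))
  (trans (cong₂ _+_ (2*half M) (evenness+ M)) (+-comm (suc M) 1))
  where
  lemma : ∀ e ρ ρ′ → 2 * (e + ρ) + ρ′ ≡ 2 * e + ρ + (ρ + ρ′)
  lemma = solve-∀

-- Closed form of M + (M - 2) + (M - 4) + ..., for both parities at once; `area S` is the number c
-- of elements of T.
area : ℕ → ℕ
area M = half M * (half M + evenness M)

-- The first column of the staircase of M + 1 has `half (suc M)` boxes, and removing it leaves the
-- staircase of M.
area-suc : ∀ M → area (suc M) ≡ half (suc M) + area M
area-suc M = trans (cong ((half M + evenness M) *_)
    (trans (+-assoc (half M) _ _) (cong (half M +_) (evenness+ M))))
  (lemma (half M) (evenness M))
  where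
  lemma : ∀ e ρ → (e + ρ) * (e + 1) ≡ e + ρ + e * (e + ρ)
  lemma = solve-∀

∑-staircase : ∀ m M → half M ≤ m → ∑ m (λ k → M ∸ 2 * k) ≡ area M
∑-staircase m zero _ = ∑-zero m (λ k _ → 0∸n≡0 (2 * k))
∑-staircase zero (suc zero) ()
∑-staircase (suc m) (suc zero) _ = cong suc (∑-zero m (λ k _ → trans (cong (1 ∸_) (*-suc 2 k)) (0∸n≡0 (1 + 2 * k))))
-- The row k = 0 has M + 2 boxes and the other rows form the staircase of M; on closed forms this is
-- `area-suc` twice. The induction hypothesis is taken at `pred m` because m is seen to be positive
-- only afterwards.
∑-staircase m (suc (suc M)) le with half M | evenness M | evenness+ M | area-suc M | area-suc (suc M) | 2*half M | ∑-staircase (pred m) M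
... | e | ρ | ρ+ρ′ | eq₁ | eq₂ | eq₃ | ih with m | subst (_≤ m) (trans (+-assoc e ρ _) (trans (cong (e +_) ρ+ρ′) (+-comm e 1))) le
... | suc m′ | s≤s le′ = begin
  suc (suc M) + ∑ m′ (λ k → suc (suc M) ∸ 2 * suc k)
    ≡⟨ cong (suc (suc M) +_) (trans (∑-cong m′ (λ k _ → cong (suc (suc M) ∸_) (*-suc 2 k))) (ih le′)) ⟩
  suc (suc M) + e * (e + ρ)
    ≡⟨ cong (λ x → suc x + e * (e + ρ)) (sym eq₃) ⟩
  suc (2 * e + ρ) + e * (e + ρ)
    ≡⟨ cong (λ x → x + (2 * e + ρ) + e * (e + ρ)) (sym ρ+ρ′) ⟩
  ρ + (1 ∸ ρ) + (2 * e + ρ) + e * (e + ρ)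
    ≡⟨ lemma e ρ (1 ∸ ρ) ⟩
  e + ρ + (1 ∸ ρ) + (e + ρ + e * (e + ρ))
    ≡⟨ cong (e + ρ + (1 ∸ ρ) +_) (sym eq₁) ⟩
  e + ρ + (1 ∸ ρ) + ((e + ρ) * (e + ρ + (1 ∸ ρ)))
    ≡⟨ sym eq₂ ⟩
  _ ∎
  where
  open ≡-Reasoning
  lemma : ∀ e ρ ρ′ → ρ + ρ′ + (2 * e + ρ) + e * (e + ρ) ≡ e + ρ + ρ′ + (e + ρ + e * (e + ρ))
  lemma = solve-∀

<half⇒<staircase : ∀ {M k} → k < half M → 0 < M ∸ 2 * k
<half⇒<staircase {M} {k} k<e = m<n⇒0<n∸m (s≤s⁻¹ (≤-trans (≤-reflexive (lemma k))
  (≤-trans (*-monoʳ-≤ 2 k<e) (≤-trans (m≤m+n (2 * half M) (evenness M)) (≤-reflexive (2*half M))))))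
  where
  lemma : ∀ k → suc (suc (2 * k)) ≡ 2 * suc k
  lemma = solve-∀

≥half⇒staircase≡0 : ∀ {M k} → half M ≤ k → M ∸ 2 * k ≡ 0
≥half⇒staircase≡0 {M} {k} e≤k = m≤n⇒m∸n≡0 (≤-trans (s≤s⁻¹ (≤-trans (≤-reflexive (sym (2*half M)))
  (≤-trans (+-monoʳ-≤ (2 * half M) ρ≤1) (≤-reflexive (+-comm (2 * half M) 1))))) (*-monoʳ-≤ 2 e≤k))
  where
  ρ≤1 : evenness M ≤ 1
  ρ≤1 = ≤-trans (m≤m+n (evenness M) (evenness (suc M))) (≤-reflexive (evenness+ M))

-- Here `r k` counts the elements missing from row k. The field `rising` says that `r (suc k)` is at
-- least the minimum of `r k` and the length of row k + 1: after pushing to the left, a column that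
-- has a missing element keeps missing them in all later rows that it meets.
record Staircase (M : ℕ) (r : ℕ → ℕ) : Set where
  field
    bounded : ∀ k → r k ≤ M ∸ 2 * k
    rising  : ∀ k i → i ≤ r k → i ≤ M ∸ 2 * suc k → i ≤ r (suc k)

open Staircase

Staircase-pred : ∀ {M r} → Staircase (suc M) r → Staircase M (λ k → pred (r k))
Staircase-pred {M} {r} st .bounded k = ≤-trans (pred-mono-≤ (bounded st k)) (≤-reflexive (pred[m∸n]≡m∸[1+n] (suc M) (2 * k)))
Staircase-pred {M} {r} st .rising k zero    _ _ = z≤n
Staircase-pred {M} {r} st .rising k (suc i) p q = pred-mono-≤ (rising st k (suc (suc i)) (suc-pred-≤ p)
  (suc-∸ {M = M} {2 * suc k} q))
  where
  suc-pred-≤ : ∀ {i n} → suc i ≤ pred n → suc (suc i) ≤ n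
  suc-pred-≤ {n = suc n} p = s≤s p
  suc-∸ : ∀ {i M n} → suc i ≤ M ∸ n → suc (suc i) ≤ suc M ∸ n
  suc-∸ {M = M}     {zero}  p = s≤s p
  suc-∸ {M = suc M} {suc n} p = suc-∸ {M = M} {n} p

-- This is `rising` at `i = 1`, iterated. Every row before `half M` is nonempty, so the bound by the
-- row length never interferes.
Staircase-column : ∀ {M r} → Staircase M r → ∀ {q} → 0 < r q → ∀ d → q + d < half M → 0 < r (q + d)
Staircase-column st {q} 0<r zero _ rewrite +-identityʳ q = 0<r
Staircase-column {M} st {q} 0<r (suc d) lt rewrite +-suc q d =
  rising st (q + d) 1 (Staircase-column st 0<r d (<-trans (n<1+n _) lt)) (<half⇒<staircase {M} lt)

search : ∀ m (r : ℕ → ℕ) → (∀ k → k < m → r k ≡ 0) ⊎ (∃[ q ] q < m × 0 < r q × (∀ k → k < q → r k ≡ 0))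
search zero    r = inj₁ (λ _ ())
search (suc m) r with r 0 in eq | search m (λ k → r (suc k))
... | suc x | _ = inj₂ (0 , z<s , subst (0 <_) (sym eq) z<s , λ _ ())
... | zero  | inj₁ all0 = inj₁ λ { zero _ → eq ; (suc k) (s≤s k<m) → all0 k k<m }
... | zero  | inj₂ (q , q<m , 0<r , before) =
  inj₂ (suc q , s≤s q<m , 0<r , λ { zero _ → eq ; (suc k) (s≤s k<q) → before k k<q })

-- Peeling off the columns of a staircase

sgn : ℕ → ℕ
sgn zero    = 0
sgn (suc _) = 1

-- The row k contributes the numbers k A + b, k A + b + 1, ..., r k of them.
rowSum : ℕ → ℕ → (ℕ → ℕ) → ℕ → ℕ
rowSum A b r k = r k * (k * A + b) + choose₂ (r k)

-- With A = s + 2 and b = 1 this is ∑Y + R (R + 1) / 2 for Y pushed to the left, to be compared with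
-- c R. Other values of b account for columns already removed.
total : ℕ → ℕ → ℕ → (ℕ → ℕ) → ℕ
total A b m r = ∑ m (rowSum A b r) + choose₂ (suc (∑ m r))

∑-sgn+pred : ∀ m (r : ℕ → ℕ) → ∑ m r ≡ ∑ m (λ k → sgn (r k)) + ∑ m (λ k → pred (r k))
∑-sgn+pred m r = trans (∑-cong m (λ k _ → lemma (r k))) (∑-+ m _ _)
  where
  lemma : ∀ x → x ≡ sgn x + pred x
  lemma zero    = refl
  lemma (suc x) = refl

columnSum : ℕ → ℕ → ℕ → (ℕ → ℕ) → ℕ
columnSum A b m σ = A * ∑ m (λ k → σ k * k) + b * ∑ m σ + choose₂ (suc (∑ m σ))

-- Row k splits into `sgn (r k)` elements in the first column and `pred (r k)` others. With n and R
-- elements in the two groups, the triangular number of n + R leaves a cross term n R, which charges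
-- n to each remaining element. Together with the shift by one column this raises b by n + 1.
total-peel : ∀ A b m r → let σ = λ k → sgn (r k) in
  total A b m r ≡ columnSum A b m σ + total A (b + suc (∑ m σ)) m (λ k → pred (r k))
total-peel A b m r = begin
  ∑ m (rowSum A b r) + choose₂ (suc (∑ m r))
    ≡⟨ cong (∑ m (rowSum A b r) +_) (trans (cong (λ x → choose₂ (suc x)) (∑-sgn+pred m r)) (choose₂-suc-+ n R)) ⟩
  ∑ m (rowSum A b r) + (choose₂ (suc n) + n * R + choose₂ (suc R))
    ≡⟨ lemma₁ (∑ m (rowSum A b r)) (choose₂ (suc n)) (n * R) _ ⟩
  ∑ m (rowSum A b r) + n * R + choose₂ (suc n) + choose₂ (suc R)
    ≡⟨ cong (λ x → x + choose₂ (suc n) + choose₂ (suc R)) sums ⟩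
  (A * ∑ m (λ k → σ k * k) + b * n + ∑ m (rowSum A (b + suc n) r⁻)) + choose₂ (suc n) + choose₂ (suc R)
    ≡⟨ lemma₂ (A * ∑ m (λ k → σ k * k) + b * n) (∑ m (rowSum A (b + suc n) r⁻)) (choose₂ (suc n)) _ ⟩
  _ ∎
  where
  open ≡-Reasoning
  σ r⁻ : ℕ → ℕ
  σ k = sgn (r k)
  r⁻ k = pred (r k)
  n R : ℕ
  n = ∑ m σ
  R = ∑ m r⁻
  choose₂-suc-+ : ∀ m n → choose₂ (suc (m + n)) ≡ choose₂ (suc m) + m * n + choose₂ (suc n)
  choose₂-suc-+ m n = trans (cong (m + n +_) (choose₂-+ m n)) (lemma m n (choose₂ m) (choose₂ n))
    where
    lemma : ∀ m n a b → m + n + (a + m * n + b) ≡ m + a + m * n + (n + b)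
    lemma = solve-∀
  lemma₁ : ∀ a b c d → a + (b + c + d) ≡ a + c + b + d
  lemma₁ = solve-∀
  lemma₂ : ∀ a b c d → a + b + c + d ≡ a + c + (b + d)
  lemma₂ = solve-∀
  peel-row : ∀ k x → x * (k * A + b) + choose₂ x + n * pred x
    ≡ (A * (sgn x * k) + b * sgn x) + (pred x * (k * A + (b + suc n)) + choose₂ (pred x))
  peel-row k zero    = lemma A b n
    where
    lemma : ∀ A b n → n * 0 ≡ A * 0 + b * 0 + 0
    lemma = solve-∀
  peel-row k (suc x) = lemma A b n k x (choose₂ x)
    where
    lemma : ∀ A b n k x c → suc x * (k * A + b) + (x + c) + n * x
      ≡ (A * (1 * k) + b * 1) + (x * (k * A + (b + suc n)) + c)
    lemma = solve-∀
  sums : ∑ m (rowSum A b r) + n * R ≡ A * ∑ m (λ k → σ k * k) + b * n + ∑ m (rowSum A (b + suc n) r⁻)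
  sums = begin
    ∑ m (rowSum A b r) + n * R
      ≡⟨ cong (∑ m (rowSum A b r) +_) (sym (∑-* m n r⁻)) ⟩
    ∑ m (rowSum A b r) + ∑ m (λ k → n * r⁻ k)
      ≡⟨ sym (∑-+ m _ _) ⟩
    ∑ m (λ k → rowSum A b r k + n * r⁻ k)
      ≡⟨ ∑-cong m (λ k _ → peel-row k (r k)) ⟩
    ∑ m (λ k → (A * (σ k * k) + b * σ k) + rowSum A (b + suc n) r⁻ k)
      ≡⟨ ∑-+ m _ _ ⟩
    ∑ m (λ k → A * (σ k * k) + b * σ k) + ∑ m (rowSum A (b + suc n) r⁻)
      ≡⟨ cong (_+ ∑ m (rowSum A (b + suc n) r⁻)) (trans (∑-+ m _ _) (cong₂ _+_ (∑-* m A _) (∑-* m b σ))) ⟩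
    _ ∎

∑-interval : ∀ {m} q n (σ g : ℕ → ℕ) → q + n ≤ m → (∀ k → k < q → σ k ≡ 0) →
  (∀ i → i < n → σ (q + i) ≡ 1) → (∀ k → q + n ≤ k → σ k ≡ 0) →
  ∑ m (λ k → σ k * g k) ≡ ∑ n (λ i → g (q + i))
∑-interval {m} q n σ g le before on after = begin
  ∑ m h
    ≡⟨ cong (λ x → ∑ x h) (sym (m+[n∸m]≡n le)) ⟩
  ∑ (q + n + (m ∸ (q + n))) h
    ≡⟨ ∑-split (q + n) _ h ⟩
  ∑ (q + n) h + ∑ (m ∸ (q + n)) (λ i → h (q + n + i))
    ≡⟨ cong (∑ (q + n) h +_) (∑-zero (m ∸ (q + n)) (λ i _ → cong (_* g (q + n + i)) (after _ (m≤m+n (q + n) i)))) ⟩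
  ∑ (q + n) h + 0
    ≡⟨ +-identityʳ _ ⟩
  ∑ (q + n) h
    ≡⟨ ∑-split q n h ⟩
  ∑ q h + ∑ n (λ i → h (q + i))
    ≡⟨ cong (_+ ∑ n (λ i → h (q + i))) (∑-zero q (λ k k<q → cong (_* g k) (before k k<q))) ⟩
  ∑ n (λ i → h (q + i))
    ≡⟨ ∑-cong n (λ i i<n → trans (cong (_* g (q + i)) (on i i<n)) (*-identityˡ _)) ⟩
  ∑ n (λ i → g (q + i)) ∎
  where
  open ≡-Reasoning
  h : ℕ → ℕ
  h k = σ k * g k

2*∑-arithmetic : ∀ q n → 2 * ∑ n (λ i → q + i) + n ≡ n * (2 * q + n)
2*∑-arithmetic q zero    = refl
2*∑-arithmetic q (suc n) = trans
  (cong (λ x → 2 * x + suc n) (∑-last n (λ i → q + i)))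
  (trans (lemma q n (∑ n (λ i → q + i))) (trans (cong (_+ (2 * (q + n) + 1)) (2*∑-arithmetic q n)) (lemma′ q n)))
  where
  lemma : ∀ q n x → 2 * (x + (q + n)) + suc n ≡ 2 * x + n + (2 * (q + n) + 1)
  lemma = solve-∀
  lemma′ : ∀ q n → n * (2 * q + n) + (2 * (q + n) + 1) ≡ suc n * (2 * q + suc n)
  lemma′ = solve-∀

-- The column numbered suc J meets the rows q, ..., e - 1, whose indices add up to K; e is ⌈ M / 2 ⌉
-- for M = S - J, ρ is the evenness of M, and A = S + 3 is s + 2 rewritten in e, ρ and f = suc J - ρ.
-- Substituting the lower bound for b makes the inequality an identity.
column-inequality : ∀ c b q n′ ρ f J K → let n = suc n′; e = q + n; A = 2 * e + 2 * ρ + f + 1 in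
  suc J ≡ ρ + f → suc J + c ≤ b + e * (e + ρ) + J * q → 2 * K + n ≡ n * (2 * q + n) →
  2 * (c * n) + n * (f * suc n + 2 * (q * suc e)) ≤ 2 * (A * K + b * n + choose₂ (suc n))
column-inequality c b q n′ ρ f J K J≡ inv K≡ = +-cancelʳ-≤ (2 * n * (e * (e + ρ) + J * q) + A * n) _ _ (begin
  2 * (c * n) + n * (f * suc n + 2 * (q * suc e)) + (2 * n * (e * (e + ρ) + J * q) + A * n)
    ≡⟨ lemma₁ c n f q e ρ J A ⟩
  n * (2 * c + f * suc n + 2 * (q * e) + 2 * (suc J * q) + 2 * (e * (e + ρ)) + A)
    ≡⟨ cong (λ x → n * (2 * c + f * suc n + 2 * (q * e) + 2 * (x * q) + 2 * (e * (e + ρ)) + A)) J≡ ⟩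
  n * (2 * c + f * suc n + 2 * (q * e) + 2 * ((ρ + f) * q) + 2 * (e * (e + ρ)) + A)
    ≡⟨ lemma₂ c f q n′ ρ ⟩
  n * (A * (2 * q + n) + 2 * (ρ + f + c) + suc n)
    ≡⟨ cong (λ x → n * (A * (2 * q + n) + 2 * (x + c) + suc n)) (sym J≡) ⟩
  n * (A * (2 * q + n) + 2 * (suc J + c) + suc n)
    ≤⟨ *-monoʳ-≤ n (+-monoˡ-≤ (suc n) (+-monoʳ-≤ (A * (2 * q + n)) (*-monoʳ-≤ 2 inv))) ⟩
  n * (A * (2 * q + n) + 2 * (b + e * (e + ρ) + J * q) + suc n)
    ≡⟨ lemma₃ n A q b (e * (e + ρ)) (J * q) ⟩
  A * (n * (2 * q + n)) + 2 * (b * n) + n * suc n + 2 * n * (e * (e + ρ) + J * q)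
    ≡⟨ cong₂ (λ x y → A * x + 2 * (b * n) + y + 2 * n * (e * (e + ρ) + J * q)) (sym K≡) (sym (2*choose₂-suc n)) ⟩
  A * (2 * K + n) + 2 * (b * n) + 2 * choose₂ (suc n) + 2 * n * (e * (e + ρ) + J * q)
    ≡⟨ lemma₄ A K n (b * n) (choose₂ (suc n)) (2 * n * (e * (e + ρ) + J * q)) ⟩
  2 * (A * K + b * n + choose₂ (suc n)) + (2 * n * (e * (e + ρ) + J * q) + A * n) ∎)
  where
  open ≤-Reasoning
  n e A : ℕ
  n = suc n′
  e = q + n
  A = 2 * e + 2 * ρ + f + 1
  lemma₁ : ∀ c n f q e ρ J A → 2 * (c * n) + n * (f * suc n + 2 * (q * suc e)) + (2 * n * (e * (e + ρ) + J * q) + A * n)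
    ≡ n * (2 * c + f * suc n + 2 * (q * e) + 2 * (suc J * q) + 2 * (e * (e + ρ)) + A)
  lemma₁ = solve-∀
  lemma₂ : ∀ c f q n′ ρ → let n = suc n′; e = q + n; A = 2 * e + 2 * ρ + f + 1 in
    n * (2 * c + f * suc n + 2 * (q * e) + 2 * ((ρ + f) * q) + 2 * (e * (e + ρ)) + A)
    ≡ n * (A * (2 * q + n) + 2 * (ρ + f + c) + suc n)
  lemma₂ c f q n′ ρ = cong (suc n′ *_) (lemma c f q n′ ρ)
    where
    lemma : ∀ c f q n′ ρ →
      2 * c + f * suc (suc n′) + 2 * (q * (q + suc n′)) + 2 * ((ρ + f) * q) + 2 * ((q + suc n′) * (q + suc n′ + ρ))
        + (2 * (q + suc n′) + 2 * ρ + f + 1)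
      ≡ (2 * (q + suc n′) + 2 * ρ + f + 1) * (2 * q + suc n′) + 2 * (ρ + f + c) + suc (suc n′)
    lemma = solve-∀
  lemma₃ : ∀ n A q b x y → n * (A * (2 * q + n) + 2 * (b + x + y) + suc n)
    ≡ A * (n * (2 * q + n)) + 2 * (b * n) + n * suc n + 2 * n * (x + y)
  lemma₃ = solve-∀
  lemma₄ : ∀ A K n x y z → A * (2 * K + n) + 2 * x + 2 * y + z ≡ 2 * (A * K + x + y) + (z + A * n)
  lemma₄ = solve-∀

-- Column number suc J, whose boxes occupy the rows q, ..., half M - 1.
record Column (c m M J b : ℕ) (r : ℕ → ℕ) : Set where
  field
    {q n M⁻}  : ℕ
    M≡        : M ≡ suc M⁻
    0<n       : 0 < n
    before    : ∀ k → k < q → r k ≡ 0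
    on        : ∀ k → q ≤ k → k < half M → 0 < r k
    n≡        : ∑ m (λ k → sgn (r k)) ≡ n
    gain      : 2 * (c * n) + n * ((suc J ∸ evenness M) * suc n + 2 * (q * suc (half M)))
                  ≤ 2 * columnSum (M + J + 3) b m (λ k → sgn (r k))
    invariant : suc (suc J) + c ≤ (b + suc n) + area M⁻ + suc J * q

-- The inequality on c is the invariant of the peeling. When J columns have been removed, b is 1 + J
-- plus the sum of their counts n, and c - `area M` is the sum of their heights n + q. Their
-- starting rows are at most the present q, so these heights exceed the counts by at most J q in
-- total.
leading-column : ∀ c m M J b q (r : ℕ → ℕ) → half M ≤ m → Staircase M r → (∀ k → k < q → r k ≡ 0) →
  suc J + c ≤ b + area M + J * q → (∀ k → k < m → r k ≡ 0) ⊎ Column c m M J b r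
leading-column c m zero J b q r _ st _ _ = inj₁ (λ k _ → n≤0⇒n≡0 (≤-trans (bounded st k) (≤-reflexive (0∸n≡0 (2 * k)))))
leading-column c m M@(suc M⁻) J b q₀ r e≤m st before₀ inv₀ with search m r
... | inj₁ all0 = inj₁ all0
... | inj₂ (q , q<m , 0<rq , before) = inj₂ (go n refl)
  where
  q<e : q < half M
  q<e = ≰⇒> λ e≤q → <⇒≢ 0<rq (sym (n≤0⇒n≡0 (≤-trans (bounded st q) (≤-reflexive (≥half⇒staircase≡0 {M} e≤q)))))
  n : ℕ
  n = half M ∸ q
  q+n≡e : q + n ≡ half M
  q+n≡e = m+[n∸m]≡n (<⇒≤ q<e)
  -- Rows that were empty before stay empty, so this column starts no earlier than the previous one,
  -- and replacing q₀ by q preserves the invariant.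
  q₀≤q : q₀ ≤ q
  q₀≤q = ≮⇒≥ λ q<q₀ → <⇒≢ 0<rq (sym (before₀ q q<q₀))
  inv : suc J + c ≤ b + area M + J * q
  inv = ≤-trans inv₀ (+-monoʳ-≤ (b + area M) (*-monoʳ-≤ J q₀≤q))
  sgn≡1 : ∀ {x} → 0 < x → sgn x ≡ 1
  sgn≡1 {suc x} _ = refl
  σ : ℕ → ℕ
  σ k = sgn (r k)
  on : ∀ i → i < n → σ (q + i) ≡ 1
  on i i<n = sgn≡1 (Staircase-column st 0<rq i (<-≤-trans (+-monoʳ-< q i<n) (≤-reflexive q+n≡e)))
  after : ∀ k → q + n ≤ k → σ k ≡ 0
  after k le = cong sgn (n≤0⇒n≡0 (≤-trans (bounded st k)
    (≤-reflexive (≥half⇒staircase≡0 {M} (≤-trans (≤-reflexive (sym q+n≡e)) le)))))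
  interval : ∀ g → ∑ m (λ k → σ k * g k) ≡ ∑ n (λ i → g (q + i))
  interval g = ∑-interval q n σ g (≤-trans (≤-reflexive q+n≡e) e≤m) (λ k k<q → cong sgn (before k k<q)) on after
  ∑σ≡n : ∑ m σ ≡ n
  ∑σ≡n = trans (∑-cong m (λ k _ → sym (*-identityʳ (σ k)))) (trans (interval (λ _ → 1)) (∑-const n))
  -- `column-inequality` wants n in the form `suc n′`; n is not 0 because q < `half M`.
  go : ∀ n₀ → n ≡ n₀ → Column c m M J b r
  go zero     eq = contradiction q<e (<-irrefl (trans (sym (+-identityʳ q)) (trans (cong (q +_) (sym eq)) q+n≡e)))
  go (suc n′) eq = record
    { M≡ = refl ; 0<n = subst (0 <_) (sym eq) z<s ; before = before
    ; on = λ k q≤k k<e → subst (λ x → 0 < r x) (m+[n∸m]≡n q≤k)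
        (Staircase-column st 0<rq (k ∸ q) (≤-trans (≤-reflexive (cong suc (m+[n∸m]≡n q≤k))) k<e))
    ; n≡ = ∑σ≡n
    ; gain = gain
    ; invariant = invariant }
    where
    ρ f K : ℕ
    ρ = evenness M
    f = suc J ∸ ρ
    K = ∑ m (λ k → σ k * k)
    ρ≤1 : ρ ≤ 1
    ρ≤1 = ≤-trans (m≤m+n ρ (evenness (suc M))) (≤-reflexive (evenness+ M))
    ρ+f≡ : suc J ≡ ρ + f
    ρ+f≡ = sym (m+[n∸m]≡n (≤-trans ρ≤1 (s≤s z≤n)))
    K≡ : 2 * K + n ≡ n * (2 * q + n)
    K≡ = trans (cong (λ x → 2 * x + n) (interval (λ k → k))) (2*∑-arithmetic q n)
    e≡ : half M ≡ q + suc n′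
    e≡ = trans (sym q+n≡e) (cong (q +_) eq)
    A≡ : 2 * (q + suc n′) + 2 * ρ + f + 1 ≡ M + J + 3
    A≡ = begin
      2 * (q + suc n′) + 2 * ρ + f + 1
        ≡⟨ cong (λ x → 2 * x + 2 * ρ + f + 1) (sym e≡) ⟩
      2 * half M + 2 * ρ + f + 1
        ≡⟨ lemma (half M) ρ f ⟩
      (2 * half M + ρ) + (ρ + f) + 1
        ≡⟨ cong₂ (λ x y → x + y + 1) (2*half M) (sym ρ+f≡) ⟩
      suc M + suc J + 1
        ≡⟨ lemma′ M J ⟩
      M + J + 3 ∎
      where
      open ≡-Reasoning
      lemma : ∀ e ρ f → 2 * e + 2 * ρ + f + 1 ≡ (2 * e + ρ) + (ρ + f) + 1
      lemma = solve-∀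
      lemma′ : ∀ M J → suc M + suc J + 1 ≡ M + J + 3
      lemma′ = solve-∀
    gain : 2 * (c * n) + n * (f * suc n + 2 * (q * suc (half M))) ≤ 2 * columnSum (M + J + 3) b m σ
    gain = begin
      2 * (c * n) + n * (f * suc n + 2 * (q * suc (half M)))
        ≡⟨ cong₂ (λ x y → 2 * (c * x) + x * (f * suc x + 2 * (q * suc y))) eq e≡ ⟩
      _ ≤⟨ column-inequality c b q n′ ρ f J K ρ+f≡
             (subst (λ x → suc J + c ≤ b + x * (x + ρ) + J * q) e≡ inv)
             (subst (λ x → 2 * K + x ≡ x * (2 * q + x)) eq K≡) ⟩
      2 * ((2 * (q + suc n′) + 2 * ρ + f + 1) * K + b * suc n′ + choose₂ (suc (suc n′)))
        ≡⟨ cong₂ (λ x y → 2 * (x * K + b * y + choose₂ (suc y))) A≡ (trans (sym eq) (sym ∑σ≡n)) ⟩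
      2 * columnSum (M + J + 3) b m σ ∎
      where open ≤-Reasoning
    -- The column removes `half M` = q + n from the area: n moves into b, and q turns J q into (J +
    -- 1) q.
    invariant : suc (suc J) + c ≤ (b + suc n) + area M⁻ + suc J * q
    invariant = begin
      suc (suc J + c)                             ≤⟨ s≤s inv ⟩
      suc (b + area M + J * q)                    ≡⟨ cong (λ x → suc (b + x + J * q)) (area-suc M⁻) ⟩
      suc (b + (half M + area M⁻) + J * q)        ≡⟨ cong (λ x → suc (b + (x + area M⁻) + J * q)) (sym q+n≡e) ⟩
      suc (b + (q + n + area M⁻) + J * q)         ≡⟨ lemma b q n (area M⁻) J ⟩
      (b + suc n) + area M⁻ + suc J * q           ∎
      where
      open ≤-Reasoning
      lemma : ∀ b q n a J → suc (b + (q + n + a) + J * q) ≡ (b + suc n) + a + suc J * q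
      lemma = solve-∀

halve : ∀ x y → 2 * x ≤ 2 * y → x ≤ y
halve x y = *-cancelˡ-≤ {x} {y} 2

-- From the second column on, `suc (suc J) ∸ evenness M` is at least 1, so the surplus in `gain` is
-- at least n (n + 1) ≥ 2 n. Each element therefore pays for c + 1 instead of c, and the induction
-- removes one column at a time.
later-columns : ∀ c m M J b q (r : ℕ → ℕ) → half M ≤ m → Staircase M r → (∀ k → k < q → r k ≡ 0) →
  suc (suc J) + c ≤ b + area M + suc J * q → suc c * ∑ m r ≤ total (M + suc J + 3) b m r
later-columns c m M J b q r e≤m st before inv with leading-column c m M (suc J) b q r e≤m st before inv
... | inj₁ all0 rewrite ∑-zero m all0 | *-zeroʳ c = z≤n
later-columns c m (suc M) J b q₀ r e≤m st before₀ inv₀ | inj₂ record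
  { q = q ; n = n ; M≡ = refl ; 0<n = 0<n ; before = before ; n≡ = n≡ ; gain = gain ; invariant = invariant } = begin
  suc c * ∑ m r
    ≡⟨ cong (suc c *_) (trans (∑-sgn+pred m r) (cong (_+ R) n≡)) ⟩
  suc c * (n + R)
    ≡⟨ *-distribˡ-+ (suc c) n R ⟩
  suc c * n + suc c * R
    ≤⟨ +-mono-≤ (halve (suc c * n) (columnSum A b m σ) this-column) rest ⟩
  columnSum A b m σ + total (M + suc (suc J) + 3) (b + suc n) m r⁻
    ≡⟨ cong₂ (λ x y → columnSum A b m σ + total x (b + suc y) m r⁻) (cong (_+ 3) (+-suc M (suc J))) (sym n≡) ⟩
  columnSum A b m σ + total A (b + suc (∑ m σ)) m r⁻
    ≡⟨ sym (total-peel A b m r) ⟩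
  total A b m r ∎
  where
  open ≤-Reasoning
  A R : ℕ
  A = suc M + suc J + 3
  σ r⁻ : ℕ → ℕ
  σ k = sgn (r k)
  r⁻ k = pred (r k)
  R = ∑ m r⁻
  f≥1 : 1 ≤ suc (suc J) ∸ evenness (suc M)
  f≥1 with evenness (suc M) | evenness-cases (suc M)
  ... | _ | inj₁ refl = s≤s z≤n
  ... | _ | inj₂ refl = s≤s z≤n
  this-column : 2 * (suc c * n) ≤ 2 * columnSum A b m σ
  this-column = begin
    2 * (suc c * n)
      ≡⟨ lemma c n ⟩
    2 * (c * n) + n * (1 * 2)
      ≤⟨ +-monoʳ-≤ (2 * (c * n)) (*-monoʳ-≤ n (m≤n⇒m≤n+o _ (*-mono-≤ f≥1 (s≤s 0<n)))) ⟩
    2 * (c * n) + n * ((suc (suc J) ∸ evenness (suc M)) * suc n + 2 * (q * suc (half (suc M))))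
      ≤⟨ gain ⟩
    2 * columnSum A b m σ ∎
    where
    lemma : ∀ c n → 2 * (suc c * n) ≡ 2 * (c * n) + n * (1 * 2)
    lemma = solve-∀
  rest : suc c * R ≤ total (M + suc (suc J) + 3) (b + suc n) m r⁻
  rest = later-columns c m M (suc J) (b + suc n) q r⁻ (≤-trans (m≤m+n (half M) (evenness M)) e≤m)
    (Staircase-pred st) (λ k k<q → cong pred (before k k<q)) invariant

-- The first column satisfies the invariant with equality. Only its surplus can vanish, since each
-- element of a later column contributes an excess of 1.
staircase-bound : ∀ m M (r : ℕ → ℕ) → half M ≤ m → Staircase M r →
  let c = area M; R = ∑ m r in
  c * R ≤ total (M + 3) 1 m r ×
  (total (M + 3) 1 m r ≤ c * R →
    R ≡ 0 ⊎ (evenness M ≡ 1 × (∀ k → k < half M → r k ≡ 1)))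
staircase-bound m M r e≤m st
  with leading-column (area M) m M 0 1 0 r e≤m st (λ _ ()) (≤-reflexive (sym (+-identityʳ _)))
... | inj₁ all0 rewrite ∑-zero m all0 | *-zeroʳ (area M) = z≤n , λ _ → inj₁ refl
staircase-bound m (suc M) r e≤m st | inj₂ record
  { q = q ; n = n ; M≡ = refl ; 0<n = 0<n ; before = before ; on = on ; n≡ = n≡ ; gain = gain ; invariant = invariant } =
  halve (c * R) (total A 1 m r) (≤-trans (m≤m+n (2 * (c * R)) (X + 2 * R⁻)) bound) , equality
  where
  c A R R⁻ f X : ℕ
  σ r⁻ : ℕ → ℕ
  c = area (suc M)
  A = suc M + 3
  R = ∑ m r
  σ k = sgn (r k)
  r⁻ k = pred (r k)
  R⁻ = ∑ m r⁻
  f = 1 ∸ evenness (suc M)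
  X = n * (f * suc n + 2 * (q * suc (half (suc M))))
  rest : suc c * R⁻ ≤ total (M + 1 + 3) (1 + suc n) m r⁻
  rest = later-columns c m M 0 (1 + suc n) q r⁻ (≤-trans (m≤m+n (half M) (evenness M)) e≤m)
    (Staircase-pred st) (λ k k<q → cong pred (before k k<q)) invariant
  bound : 2 * (c * R) + (X + 2 * R⁻) ≤ 2 * total A 1 m r
  bound = begin
    2 * (c * R) + (X + 2 * R⁻)
      ≡⟨ cong (λ x → 2 * (c * x) + (X + 2 * R⁻)) (trans (∑-sgn+pred m r) (cong (_+ R⁻) n≡)) ⟩
    2 * (c * (n + R⁻)) + (X + 2 * R⁻)
      ≡⟨ lemma c n R⁻ X ⟩
    2 * (c * n) + X + 2 * (suc c * R⁻)
      ≤⟨ +-mono-≤ gain (*-monoʳ-≤ 2 rest) ⟩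
    2 * columnSum (suc M + 0 + 3) 1 m σ + 2 * total (M + 1 + 3) (1 + suc n) m r⁻
      ≡⟨ cong₂ (λ x y → 2 * columnSum x 1 m σ + 2 * total y (1 + suc n) m r⁻)
           (cong (_+ 3) (+-identityʳ (suc M))) (cong (_+ 3) (+-comm M 1)) ⟩
    2 * columnSum A 1 m σ + 2 * total A (1 + suc n) m r⁻
      ≡⟨ sym (*-distribˡ-+ 2 (columnSum A 1 m σ) _) ⟩
    2 * (columnSum A 1 m σ + total A (1 + suc n) m r⁻)
      ≡⟨ cong (λ x → 2 * (columnSum A 1 m σ + total A (1 + suc x) m r⁻)) (sym n≡) ⟩
    2 * (columnSum A 1 m σ + total A (1 + suc (∑ m σ)) m r⁻)
      ≡⟨ cong (2 *_) (sym (total-peel A 1 m r)) ⟩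
    2 * total A 1 m r ∎
    where
    open ≤-Reasoning
    lemma : ∀ c n R X → 2 * (c * (n + R)) + (X + 2 * R) ≡ 2 * (c * n) + X + 2 * (suc c * R)
    lemma = solve-∀
  equality : total A 1 m r ≤ c * R → R ≡ 0 ⊎ (evenness (suc M) ≡ 1 × (∀ k → k < half (suc M) → r k ≡ 1))
  equality le = inj₂ (odd , λ k k<e → ≤-antisym
      (pred≡0 (∑≡0⇒≡0 m R⁻≡0 k (<-≤-trans k<e e≤m)))
      (on k (subst (_≤ k) (sym q≡0) z≤n) k<e))
    where
    -- X is twice the surplus of the first column and 2 R⁻ that of the later ones. Both vanish,
    -- which leaves no later column, an even M and a first column starting in row 0.
    slack≡0 : X + 2 * R⁻ ≡ 0
    slack≡0 = n≤0⇒n≡0 (+-cancelˡ-≤ (2 * (c * R)) _ _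
      (≤-trans bound (≤-trans (*-monoʳ-≤ 2 le) (≤-reflexive (sym (+-identityʳ _))))))
    R⁻≡0 : R⁻ ≡ 0
    R⁻≡0 = m+n≡0⇒m≡0 R⁻ (m+n≡0⇒n≡0 X slack≡0)
    cofactor≡0 : ∀ {n x} → 0 < n → n * x ≡ 0 → x ≡ 0
    cofactor≡0 {n} {x} 0<n eq with m*n≡0⇒m≡0∨n≡0 n eq
    ... | inj₁ n≡0 = contradiction (sym n≡0) (<⇒≢ 0<n)
    ... | inj₂ x≡0 = x≡0
    Y≡0 : f * suc n + 2 * (q * suc (half (suc M))) ≡ 0
    Y≡0 = cofactor≡0 0<n (m+n≡0⇒m≡0 X slack≡0)
    odd : evenness (suc M) ≡ 1
    odd = [ (λ ρ≡0 → contradiction (trans (cong (1 ∸_) (sym ρ≡0)) f≡0) λ ()) , (λ ρ≡1 → ρ≡1) ]′ (evenness-cases (suc M))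
      where
      f≡0 : f ≡ 0
      f≡0 = cofactor≡0 {suc n} z<s (trans (*-comm (suc n) f) (m+n≡0⇒m≡0 (f * suc n) Y≡0))
    q≡0 : q ≡ 0
    q≡0 = cofactor≡0 {suc (half (suc M))} z<s (trans (*-comm (suc (half (suc M))) q)
      (cofactor≡0 {2} z<s (m+n≡0⇒n≡0 (f * suc n) Y≡0)))
    pred≡0 : ∀ {x} → pred x ≡ 0 → x ≤ 1
    pred≡0 {zero}        _  = z≤n
    pred≡0 {suc zero}    _  = s≤s z≤n
    pred≡0 {suc (suc x)} ()

-- Partitions, conjugation and β-sets

Partition-≡ : ∀ {p q} → parts p ≡ parts q → p ≡ q
Partition-≡ {mkPartition xs pos dec} {mkPartition .xs pos′ dec′} refl
  = cong₂ (mkPartition xs) (All.irrelevant ≤-irrelevant pos pos′) (Linked.irrelevant ≤-irrelevant dec dec′)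

Decreasing : List ℕ → Set
Decreasing = AllPairs _≥_

decreasing⇒ : ∀ p → Decreasing (parts p)
decreasing⇒ p = Linked.Linked⇒AllPairs (λ x≥y y≥z → ≤-trans y≥z x≥y) (decreasing p)

countAbove-< : ∀ {j x} xs → j < x → countAbove j (x ∷ xs) ≡ suc (countAbove j xs)
countAbove-< {j} xs j<x = cong length (filter-accept (j <?_) j<x)

countAbove-≥ : ∀ {j x} xs → x ≤ j → countAbove j (x ∷ xs) ≡ countAbove j xs
countAbove-≥ {j} xs x≤j = cong length (filter-reject (j <?_) (≤⇒≯ x≤j))

countAbove-none : ∀ {j xs} → All (_≤ j) xs → countAbove j xs ≡ 0
countAbove-none []       = refl
countAbove-none {xs = _ ∷ xs} (le ∷ les) = trans (countAbove-≥ xs le) (countAbove-none les)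

countAbove-0 : ∀ {xs} → All (0 <_) xs → countAbove 0 xs ≡ length xs
countAbove-0 []       = refl
countAbove-0 {_ ∷ xs} (p ∷ ps) = trans (countAbove-< xs p) (cong suc (countAbove-0 ps))

-- In a decreasing list the entries above j form an initial segment. With its converse this makes
-- conjugation the reflection of the diagram.
<nth⇒<countAbove : ∀ {xs} → Decreasing xs → ∀ i j → j < nth xs i → i < countAbove j xs
<nth⇒<countAbove {x ∷ xs} (_ ∷ _) zero j j<x rewrite countAbove-< xs j<x = z<s
<nth⇒<countAbove {x ∷ xs} (x≥ ∷ dec) (suc i) j lt with j <? x
... | yes j<x rewrite countAbove-< xs j<x = s<s (<nth⇒<countAbove dec i j lt)
... | no  j≮x = contradiction (<nth⇒<countAbove dec i j lt)
      (λ lt′ → n≮0 (subst (i <_) (countAbove-none (All.map (λ y≤x → ≤-trans y≤x (≮⇒≥ j≮x)) x≥)) lt′))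

<countAbove⇒<nth : ∀ {xs} → Decreasing xs → ∀ i j → i < countAbove j xs → j < nth xs i
<countAbove⇒<nth {x ∷ xs} (x≥ ∷ dec) i j lt with j <? x
... | no j≮x = contradiction (subst (i <_) (countAbove-none (≮⇒≥ j≮x ∷ All.map (λ y≤x → ≤-trans y≤x (≮⇒≥ j≮x)) x≥)) lt) n≮0
<countAbove⇒<nth {x ∷ xs} (x≥ ∷ dec) zero    j lt | yes j<x = j<x
<countAbove⇒<nth {x ∷ xs} (x≥ ∷ dec) (suc i) j lt | yes j<x rewrite countAbove-< xs j<x =
  <countAbove⇒<nth dec i j (s<s⁻¹ lt)

≡-by-< : ∀ {m n} → (∀ i → i < m → i < n) → (∀ i → i < n → i < m) → m ≡ n
≡-by-< {m} {n} to from = ≤-antisym (≮⇒≥ λ n<m → <-irrefl refl (to n n<m)) (≮⇒≥ λ m<n → <-irrefl refl (from m m<n))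

column-<⇒ : ∀ p i j → i < column p j → j < row p i
column-<⇒ p = <countAbove⇒<nth (decreasing⇒ p)

row-<⇒ : ∀ p i j → j < row p i → i < column p j
row-<⇒ p = <nth⇒<countAbove (decreasing⇒ p)

nth-applyUpTo-< : ∀ (f : ℕ → ℕ) n i → i < n → nth (applyUpTo f n) i ≡ f i
nth-applyUpTo-< f (suc n) zero    _         = refl
nth-applyUpTo-< f (suc n) (suc i) (s≤s i<n) = nth-applyUpTo-< (λ k → f (suc k)) n i i<n

nth-applyUpTo-≥ : ∀ (f : ℕ → ℕ) n i → n ≤ i → nth (applyUpTo f n) i ≡ 0
nth-applyUpTo-≥ f zero    i       _         = refl
nth-applyUpTo-≥ f (suc n) (suc i) (s≤s n≤i) = nth-applyUpTo-≥ (λ k → f (suc k)) n i n≤i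

row-conjugate : ∀ p i → row (conjugate p) i ≡ column p i
row-conjugate p i with i <? row p 0
... | yes i<x = nth-applyUpTo-< (column p) (row p 0) i i<x
... | no  i≮x = trans (nth-applyUpTo-≥ (column p) (row p 0) i (≮⇒≥ i≮x))
                  (sym (n≤0⇒n≡0 (≮⇒≥ λ 0<c → i≮x (column-<⇒ p 0 i 0<c))))

column-conjugate : ∀ p j → column (conjugate p) j ≡ row p j
column-conjugate p j = ≡-by-<
  (λ i lt → column-<⇒ p j i (subst (j <_) (row-conjugate p i) (column-<⇒ (conjugate p) i j lt)))
  (λ i lt → row-<⇒ (conjugate p) i j (subst (j <_) (sym (row-conjugate p i)) (row-<⇒ p j i lt)))

hook-conjugate : ∀ p i j → hook (conjugate p) i j ≡ hook p j i
hook-conjugate p i j = cong suc (trans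
  (cong₂ (λ x y → (x ∸ suc j) + (y ∸ suc i)) (row-conjugate p i) (column-conjugate p j))
  (+-comm (column p i ∸ suc j) _))

IsCore-conjugate : ∀ {t} p → IsCore t p → IsCore t (conjugate p)
IsCore-conjugate {t} p core i j box t∣h = core j i
  (column-<⇒ p j i (subst (j <_) (row-conjugate p i) box))
  (subst (t ∣_) (hook-conjugate p i j) t∣h)

indicator : ℕ → ℕ → ℕ
indicator x j with j <? x
... | yes _ = 1
... | no  _ = 0

countAbove-∷ : ∀ j x xs → countAbove j (x ∷ xs) ≡ indicator x j + countAbove j xs
countAbove-∷ j x xs with j <? x
... | yes j<x = countAbove-< xs j<x
... | no  j≮x = countAbove-≥ xs (≮⇒≥ j≮x)

∑-indicator : ∀ m x → x ≤ m → ∑ m (indicator x) ≡ x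
∑-indicator zero    zero    _ = refl
∑-indicator (suc m) x x≤ with m≤n⇒m<n∨m≡n x≤
... | inj₁ x<1+m = trans (∑-last m (indicator x)) (trans (cong₂ _+_ (∑-indicator m x (s≤s⁻¹ x<1+m)) off) (+-identityʳ x))
  where
  off : indicator x m ≡ 0
  off with m <? x
  ... | yes m<x = contradiction m<x (≤⇒≯ (s≤s⁻¹ x<1+m))
  ... | no  _   = refl
... | inj₂ refl = trans (∑-cong (suc m) on) (∑-const (suc m))
  where
  on : ∀ i → i < suc m → indicator (suc m) i ≡ 1
  on i i<x with i <? suc m
  ... | yes _   = refl
  ... | no  i≮x = contradiction i<x i≮x

-- Boxes are counted by columns instead of rows: a part x contributes 1 to each column j < x.
∑-countAbove : ∀ m {xs} → All (_≤ m) xs → ∑ m (λ j → countAbove j xs) ≡ sum xs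
∑-countAbove m []       = ∑-zero m (λ _ _ → refl)
∑-countAbove m {x ∷ xs} (x≤m ∷ les) = trans (∑-cong m (λ j _ → countAbove-∷ j x xs))
  (trans (∑-+ m (indicator x) (λ j → countAbove j xs)) (cong₂ _+_ (∑-indicator m x x≤m) (∑-countAbove m les)))

size-conjugate : ∀ p → size (conjugate p) ≡ size p
size-conjugate p = ∑-countAbove (row p 0) (all≤head (decreasing⇒ p))
  where
  all≤head : ∀ {xs} → Decreasing xs → All (_≤ nth xs 0) xs
  all≤head []       = []
  all≤head (x≥ ∷ _) = ≤-refl ∷ x≥

-- β-sets as strictly decreasing lists

betaList : List ℕ → List ℕ
betaList []       = []
betaList (x ∷ xs) = x + length xs ∷ betaList xs

length-betaList : ∀ xs → length (betaList xs) ≡ length xs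
length-betaList []       = refl
length-betaList (x ∷ xs) = cong suc (length-betaList xs)

sum-betaList : ∀ xs → sum (betaList xs) ≡ sum xs + choose₂ (length xs)
sum-betaList []       = refl
sum-betaList (x ∷ xs) = trans (cong (x + length xs +_) (sum-betaList xs)) (lemma x (length xs) (sum xs) _)
  where
  lemma : ∀ a b c d → a + b + (c + d) ≡ a + c + (b + d)
  lemma = solve-∀

betaList-injective : ∀ xs ys → betaList xs ≡ betaList ys → xs ≡ ys
betaList-injective []       []       _  = refl
betaList-injective (x ∷ xs) (y ∷ ys) eq with betaList-injective xs ys (∷-injectiveʳ eq)
... | refl = cong (_∷ xs) (+-cancelʳ-≡ (length xs) x y (∷-injectiveˡ eq))

betaList-< : ∀ {x xs} → All (_≤ x) xs → Decreasing xs → All (_< x + length xs) (betaList xs)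
betaList-< []         []         = []
betaList-< {x} {y ∷ xs} (y≤x ∷ les) (_ ∷ dec) rewrite +-suc x (length xs) =
  s≤s (+-monoˡ-≤ (length xs) y≤x) ∷ All.map m<n⇒m<1+n (betaList-< les dec)

betaList-strict : ∀ {xs} → Decreasing xs → AllPairs _>_ (betaList xs)
betaList-strict []         = []
betaList-strict (x≥ ∷ dec) = betaList-< x≥ dec ∷ betaList-strict dec

betaList-positive : ∀ {xs} → All (0 <_) xs → All (0 <_) (betaList xs)
betaList-positive []       = []
betaList-positive {x ∷ xs} (p ∷ ps) = m≤n⇒m≤n+o (length xs) p ∷ betaList-positive ps

∈⇒≤head : ∀ {v c cs} → All (c >_) cs → v ∈ c ∷ cs → v ≤ c
∈⇒≤head _  (here refl) = ≤-refl
∈⇒≤head c> (there v∈)  = <⇒≤ (All.lookup c> v∈)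

-- Both heads are the maximum of the same set, and strictness keeps that value out of the tails.
strict-unique : ∀ {as bs} → AllPairs _>_ as → AllPairs _>_ bs →
  (∀ {v} → v ∈ as → v ∈ bs) → (∀ {v} → v ∈ bs → v ∈ as) → as ≡ bs
strict-unique {[]}     {[]}     _ _ _ _ = refl
strict-unique {[]}     {b ∷ bs} _ _ _ from with from (here refl)
... | ()
strict-unique {a ∷ as} {[]}     _ _ to _ with to (here refl)
... | ()
strict-unique {a ∷ as} {b ∷ bs} (a> ∷ sa) (b> ∷ sb) to from = cong₂ _∷_ a≡b
  (strict-unique sa sb
    (λ v∈ → tail (to (there v∈)) (λ { refl → <-irrefl (sym a≡b) (All.lookup a> v∈) }))
    (λ v∈ → tail (from (there v∈)) (λ { refl → <-irrefl a≡b (All.lookup b> v∈) })))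
  where
  tail : ∀ {v c : ℕ} {cs} → v ∈ c ∷ cs → v ≢ c → v ∈ cs
  tail (here eq)  neq = contradiction eq neq
  tail (there v∈) _   = v∈
  a≡b : a ≡ b
  a≡b = ≤-antisym (∈⇒≤head b> (to (here refl))) (∈⇒≤head a> (from (here refl)))

fromBeta : List ℕ → List ℕ
fromBeta []       = []
fromBeta (b ∷ bs) = b ∸ length bs ∷ fromBeta bs

length-fromBeta : ∀ bs → length (fromBeta bs) ≡ length bs
length-fromBeta []       = refl
length-fromBeta (b ∷ bs) = cong suc (length-fromBeta bs)

-- The entries are distinct and positive, so the largest is at least their number. Hence `fromBeta`
-- never truncates, and its parts are positive.
strict-length< : ∀ {b bs} → AllPairs _>_ (b ∷ bs) → All (0 <_) (b ∷ bs) → length bs < b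
strict-length< {b} {[]}     _                    (0<b ∷ _) = 0<b
strict-length< {b} {c ∷ bs} ((b>c ∷ _) ∷ strict) (_ ∷ pos) = ≤-<-trans (strict-length< strict pos) b>c

betaList-fromBeta : ∀ {bs} → AllPairs _>_ bs → All (0 <_) bs → betaList (fromBeta bs) ≡ bs
betaList-fromBeta []            []            = refl
betaList-fromBeta {b ∷ bs} s@(_ ∷ strict) p@(_ ∷ pos) = cong₂ _∷_
  (trans (cong (b ∸ length bs +_) (length-fromBeta bs)) (m∸n+n≡m (<⇒≤ (strict-length< s p))))
  (betaList-fromBeta strict pos)

fromBeta-positive : ∀ {bs} → AllPairs _>_ bs → All (0 <_) bs → All (0 <_) (fromBeta bs)
fromBeta-positive []            []            = []
fromBeta-positive s@(_ ∷ strict) p@(_ ∷ pos) = m<n⇒0<n∸m (strict-length< s p) ∷ fromBeta-positive strict pos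

fromBeta-decreasing : ∀ {bs} → AllPairs _>_ bs → Linked _≥_ (fromBeta bs)
fromBeta-decreasing []       = Linked.[]
fromBeta-decreasing {_ ∷ []} _ = Linked.[-]
fromBeta-decreasing {b ∷ c ∷ bs} ((b>c ∷ _) ∷ strict) =
  -- The bound `suc c ∸ suc (length bs)` computes to `c ∸ length bs`, the next part.
  ∸-monoˡ-≤ {suc c} {b} (suc (length bs)) b>c Linked.∷ fromBeta-decreasing strict

fromBetaSet : ∀ {bs} → AllPairs _>_ bs → All (0 <_) bs → Partition
fromBetaSet {bs} strict pos = mkPartition (fromBeta bs) (fromBeta-positive strict pos) (fromBeta-decreasing strict)

-- The leg in the first column consists of all later rows, as in `betaList`. The additive form
-- avoids truncated subtraction.
firstHook : ∀ p i → Box p i 0 → hook p i 0 + suc i ≡ row p i + length (parts p)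
firstHook p i box = begin
  suc ((row p i ∸ 1) + (column p 0 ∸ suc i)) + suc i
    ≡⟨ cong (λ x → suc ((row p i ∸ 1) + (x ∸ suc i)) + suc i) (countAbove-0 (positive p)) ⟩
  suc ((row p i ∸ 1) + (n ∸ suc i)) + suc i
    ≡⟨ lemma (row p i ∸ 1) (n ∸ suc i) (suc i) ⟩
  suc (row p i ∸ 1) + (n ∸ suc i + suc i)
    ≡⟨ cong₂ _+_ (m+[n∸m]≡n box) (m∸n+n≡m (subst (i <_) (countAbove-0 (positive p)) (row-<⇒ p i 0 box))) ⟩
  row p i + n ∎
  where
  open ≡-Reasoning
  n : ℕ
  n = length (parts p)
  lemma : ∀ a b c → suc (a + b) + c ≡ suc a + (b + c)
  lemma = solve-∀

betaList-nth⁻ : ∀ xs {v} → v ∈ betaList xs → ∃[ i ] i < length xs × v + suc i ≡ nth xs i + length xs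
betaList-nth⁻ (x ∷ xs) (here refl) = 0 , z<s , lemma x (length xs)
  where
  lemma : ∀ a b → a + b + 1 ≡ a + suc b
  lemma = solve-∀
betaList-nth⁻ (x ∷ xs) {v} (there v∈) with betaList-nth⁻ xs v∈
... | i , i<n , eq = suc i , s<s i<n , trans (+-suc v (suc i)) (trans (cong suc eq) (sym (+-suc _ _)))

betaList-nth⁺ : ∀ xs i {v} → i < length xs → v + suc i ≡ nth xs i + length xs → v ∈ betaList xs
betaList-nth⁺ (x ∷ xs) zero {v} _ eq = here (suc-injective (trans (sym (trans (+-suc v 0) (cong suc (+-identityʳ v)))) (trans eq (+-suc x _))))
betaList-nth⁺ (x ∷ xs) (suc i) {v} (s≤s i<n) eq = there (betaList-nth⁺ xs i i<n
  (suc-injective (trans (sym (+-suc v (suc i))) (trans eq (+-suc _ _)))))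

nth-positive : ∀ {xs} → All (0 <_) xs → ∀ i → i < length xs → 0 < nth xs i
nth-positive (p ∷ _)  zero    _         = p
nth-positive (_ ∷ ps) (suc i) (s≤s i<n) = nth-positive ps i i<n

betaSet : Partition → List ℕ
betaSet p = betaList (parts p)

β⇒∈ : ∀ p {v} → β p v → v ∈ betaSet p
β⇒∈ p (i , box , refl) = betaList-nth⁺ (parts p) i
  (subst (i <_) (countAbove-0 (positive p)) (row-<⇒ p i 0 box)) (firstHook p i box)

∈⇒β : ∀ p {v} → v ∈ betaSet p → β p v
∈⇒β p {v} v∈ with betaList-nth⁻ (parts p) v∈
... | i , i<n , eq = i , box , +-cancelʳ-≡ (suc i) _ _ (trans (firstHook p i box) (sym eq))
  where
  box : Box p i 0
  box = nth-positive (positive p) i i<n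

betaSet-injective : ∀ p q → (∀ {v} → v ∈ betaSet p → v ∈ betaSet q) → (∀ {v} → v ∈ betaSet q → v ∈ betaSet p) → p ≡ q
betaSet-injective p q to from = Partition-≡ (betaList-injective (parts p) (parts q)
  (strict-unique (betaList-strict (decreasing⇒ p)) (betaList-strict (decreasing⇒ q)) to from))

0∉betaSet : ∀ p → 0 ∉ betaSet p
0∉betaSet p 0∈ = <-irrefl refl (All.lookup (betaList-positive (positive p)) 0∈)

-- The non-members of the β-set are j + n - (column j), one for each j.
gap-exists : ∀ {xs} → Decreasing xs → ∀ v → v ∈ betaList xs ⊎ ∃[ j ] v + countAbove j xs ≡ j + length xs
gap-exists []                v = inj₂ (v , refl)
gap-exists {x ∷ xs} (x≥ ∷ dec) v with <-cmp v (x + length xs)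
... | tri≈ _ eq _ = inj₁ (here eq)
... | tri< lt _ _ with gap-exists dec v
...   | inj₁ v∈       = inj₁ (there v∈)
...   | inj₂ (j , eq) with j <? x
...     | yes j<x = inj₂ (j , trans (cong (v +_) (countAbove-< xs j<x))
                      (trans (+-suc v _) (trans (cong suc eq) (sym (+-suc j _)))))
...     | no  j≮x = contradiction lt (≤⇒≯ (≤-trans (+-monoˡ-≤ (length xs) (≮⇒≥ j≮x)) (≤-reflexive
                      (trans (sym eq) (trans (cong (v +_) (countAbove-none (All.map (λ y≤x → ≤-trans y≤x (≮⇒≥ j≮x)) x≥))) (+-identityʳ v))))))
gap-exists {x ∷ xs} (x≥ ∷ dec) v | tri> _ _ gt = inj₂ (j , trans (cong (v +_) none) (trans (+-identityʳ v) (sym (m∸n+n≡m n<v))))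
  where
  n<v : suc (length xs) ≤ v
  n<v = ≤-trans (s≤s (m≤n+m (length xs) x)) gt
  j : ℕ
  j = v ∸ suc (length xs)
  x≤j : x ≤ j
  x≤j = m+n≤o⇒m≤o∸n x (≤-trans (≤-reflexive (+-suc x (length xs))) gt)
  none : countAbove j (x ∷ xs) ≡ 0
  none = countAbove-none (x≤j ∷ All.map (λ y≤x → ≤-trans y≤x x≤j) x≥)

-- If j is at least the first part, column j is empty and v exceeds the largest entry. Otherwise v
-- is less than the first entry, and the equation passes to the tail.
gap-∉ : ∀ {xs} → Decreasing xs → ∀ {v} j → v + countAbove j xs ≡ j + length xs → v ∉ betaList xs
gap-∉ {x ∷ xs} (x≥ ∷ dec) {v} j eq v∈ with j <? x
... | no j≮x = <-irrefl refl (≤-<-trans (≤-trans (≤-reflexive (trans (sym (+-suc j _)) (trans (sym eq) v+0))) v≤) j+n)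
  where
  v+0 : v + countAbove j (x ∷ xs) ≡ v
  v+0 = trans (cong (v +_) (countAbove-none (≮⇒≥ j≮x ∷ All.map (λ y≤x → ≤-trans y≤x (≮⇒≥ j≮x)) x≥))) (+-identityʳ v)
  v≤ : v ≤ x + length xs
  v≤ = ∈⇒≤head (betaList-< x≥ dec) v∈
  j+n : x + length xs < suc (j + length xs)
  j+n = s≤s (+-monoˡ-≤ (length xs) (≮⇒≥ j≮x))
... | yes j<x with v∈
...   | there v∈′ = gap-∉ dec j eq′ v∈′
  where
  eq′ : v + countAbove j xs ≡ j + length xs
  eq′ = suc-injective (trans (sym (+-suc v _)) (trans (cong (v +_) (sym (countAbove-< xs j<x))) (trans eq (+-suc j _))))
...   | here refl = <-irrefl refl (<-≤-trans (+-monoˡ-< (length xs) j<x)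
        (≤-trans (m≤m+n _ (countAbove j xs)) (≤-reflexive (suc-injective
          (trans (sym (+-suc _ _)) (trans (cong (x + length xs +_) (sym (countAbove-< xs j<x))) (trans eq (+-suc j _))))))))

-- A hook length is the distance between two steps of the boundary path: the β-number b of row i and
-- the gap v of column j.
hook-gap : ∀ p {i j v b} → Box p i j → b + suc i ≡ row p i + length (parts p) →
  v + column p j ≡ j + length (parts p) → v + hook p i j ≡ b
hook-gap p {i} {j} {v} {b} box b≡ v≡ = +-cancelʳ-≡ (suc i + suc j + column p j) _ _ (begin
  v + suc (x + y) + (suc i + suc j + column p j)
    ≡⟨ lemma₁ v x y i j (column p j) ⟩
  (v + column p j) + (suc j + x) + (suc i + y) + 1
    ≡⟨ cong₂ (λ a c → (v + column p j) + a + c + 1) (m+[n∸m]≡n box) (m+[n∸m]≡n (row-<⇒ p i j box)) ⟩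
  (v + column p j) + row p i + column p j + 1
    ≡⟨ cong (λ a → a + row p i + column p j + 1) v≡ ⟩
  (j + n) + row p i + column p j + 1
    ≡⟨ lemma₂ j n (row p i) (column p j) ⟩
  (row p i + n) + (suc j + column p j)
    ≡⟨ cong (_+ (suc j + column p j)) (sym b≡) ⟩
  (b + suc i) + (suc j + column p j)
    ≡⟨ lemma₃ b (suc i) (suc j) (column p j) ⟩
  b + (suc i + suc j + column p j) ∎)
  where
  open ≡-Reasoning
  n x y : ℕ
  n = length (parts p)
  x = row p i ∸ suc j
  y = column p j ∸ suc i
  lemma₁ : ∀ v x y i j c → v + suc (x + y) + (suc i + suc j + c) ≡ (v + c) + (suc j + x) + (suc i + y) + 1
  lemma₁ = solve-∀
  lemma₂ : ∀ j n r c → (j + n) + r + c + 1 ≡ (r + n) + (suc j + c)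
  lemma₂ = solve-∀
  lemma₃ : ∀ a b c d → (a + b) + (c + d) ≡ a + (b + c + d)
  lemma₃ = solve-∀

-- If v were missing it would be the gap of some column j, and the box where column j meets the row
-- of v + t would have hook length t.
core⇒closed : ∀ {t} p → IsCore t p → ∀ {v} → v + t ∈ betaSet p → v ∈ betaSet p
core⇒closed {t} p core {v} b∈ with gap-exists (decreasing⇒ p) v | betaList-nth⁻ (parts p) b∈
... | inj₁ v∈       | _ = v∈
... | inj₂ (j , v≡) | i , i<n , b≡ with j <? row p i
...   | yes box = contradiction (subst (t ∣_) (sym (+-cancelˡ-≡ v _ _ (hook-gap p box b≡ v≡))) ∣-refl) (core i j box)
-- Were this position outside the diagram, the β-number v + t of row i would lie below the gap v.
...   | no  j≮x = contradiction (begin-strict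
  v + i                         <⟨ +-mono-≤-< (m≤m+n v t) (n<1+n i) ⟩
  v + t + suc i                 ≡⟨ b≡ ⟩
  row p i + length (parts p)    ≤⟨ +-monoˡ-≤ (length (parts p)) (≮⇒≥ j≮x) ⟩
  j + length (parts p)          ≡⟨ v≡ ⟨
  v + column p j                ≤⟨ +-monoʳ-≤ v col≤i ⟩
  v + i                         ∎) (<-irrefl refl)
  where
  open ≤-Reasoning
  col≤i : column p j ≤ i
  col≤i = ≮⇒≥ λ lt → j≮x (column-<⇒ p i j lt)

-- A hook of length k t joins a β-number to a gap k t below it, and k steps of closure would put
-- that gap into the β-set.
closed⇒core : ∀ {t} p → (∀ {v} → v + t ∈ betaSet p → v ∈ betaSet p) → IsCore t p
closed⇒core {t} p closed i j box (divides k h≡) = gap-∉ (decreasing⇒ p) j v≡ (descend k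
    (subst (_∈ betaSet p) (sym (trans (cong (v +_) (sym h≡)) (hook-gap p box (firstHook p i box₀) v≡))) (β⇒∈ p (i , box₀ , refl))))
  where
  box₀ : Box p i 0
  box₀ = ≤-<-trans z≤n box
  v : ℕ
  v = j + length (parts p) ∸ column p j
  v≡ : v + column p j ≡ j + length (parts p)
  v≡ = m∸n+n≡m (m≤n⇒m≤o+n j (length-filter (j <?_) (parts p)))
  descend : ∀ k {v} → v + k * t ∈ betaSet p → v ∈ betaSet p
  descend zero    {v} v∈ = subst (_∈ betaSet p) (+-identityʳ v) v∈
  descend (suc k) {v} v∈ = closed (descend k (subst (_∈ betaSet p) (sym (+-assoc v t (k * t))) v∈))

-- The rows of T

δ : ℕ → ℕ → ℕ
δ b v with b ≟ v
... | yes _ = 1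
... | no  _ = 0

δ-≡ : ∀ b → δ b b ≡ 1
δ-≡ b with b ≟ b
... | yes _  = refl
... | no b≢b = contradiction refl b≢b

δ-≢ : ∀ {b v} → b ≢ v → δ b v ≡ 0
δ-≢ {b} {v} b≢v with b ≟ v
... | yes b≡v = contradiction b≡v b≢v
... | no  _   = refl

-- Numerical multiplicities turn sums over the list into weighted sums over an initial segment of ℕ.
-- For strictly decreasing lists they are 0 or 1.
occ : List ℕ → ℕ → ℕ
occ []       v = 0
occ (b ∷ bs) v = δ b v + occ bs v

occ-∈ : ∀ {v bs} → v ∈ bs → 0 < occ bs v
occ-∈ {v} {_ ∷ bs} (here refl) rewrite δ-≡ v = z<s
occ-∈ {v} {b ∷ bs} (there v∈)  = m≤n⇒m≤o+n (δ b v) (occ-∈ v∈)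

occ-∉ : ∀ {v} bs → v ∉ bs → occ bs v ≡ 0
occ-∉ []       _  = refl
occ-∉ (b ∷ bs) v∉ = cong₂ _+_ (δ-≢ (λ { refl → v∉ (here refl) })) (occ-∉ bs (λ v∈ → v∉ (there v∈)))

occ⇒∈ : ∀ {v} bs → 0 < occ bs v → v ∈ bs
occ⇒∈ {v} (b ∷ bs) pos with b ≟ v
... | yes refl = here refl
... | no  _    = there (occ⇒∈ bs pos)

occ≤1 : ∀ {bs} → AllPairs _>_ bs → ∀ v → occ bs v ≤ 1
occ≤1 []       v = z≤n
occ≤1 {b ∷ bs} (b> ∷ strict) v with b ≟ v
... | yes refl = s≤s (≤-reflexive (occ-∉ bs (λ v∈ → <-irrefl refl (All.lookup b> v∈))))
... | no  _    = occ≤1 strict v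

∑-occ : ∀ B {bs} (g : ℕ → ℕ) → All (_< B) bs → ∑ B (λ v → occ bs v * g v) ≡ sum (map g bs)
∑-occ B g [] = ∑-zero B (λ _ _ → refl)
∑-occ B {b ∷ bs} g (b<B ∷ bs<B) = begin
  ∑ B (λ v → (δ b v + occ bs v) * g v)
    ≡⟨ ∑-cong B (λ v _ → *-distribʳ-+ (g v) (δ b v) (occ bs v)) ⟩
  ∑ B (λ v → δ b v * g v + occ bs v * g v)
    ≡⟨ ∑-+ B _ _ ⟩
  ∑ B (λ v → δ b v * g v) + ∑ B (λ v → occ bs v * g v)
    ≡⟨ cong₂ _+_ single (∑-occ B g bs<B) ⟩
  g b + sum (map g bs) ∎
  where
  open ≡-Reasoning
  single : ∑ B (λ v → δ b v * g v) ≡ g b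
  single = trans
    (∑-interval b 1 (δ b) g (≤-trans (≤-reflexive (+-comm b 1)) b<B)
      (λ k k<b → δ-≢ (λ b≡k → <-irrefl (sym b≡k) k<b))
      (λ { zero _ → trans (cong (δ b) (+-identityʳ b)) (δ-≡ b) ; (suc _) (s≤s ()) })
      (λ k b<k → δ-≢ (λ b≡k → <-irrefl b≡k (≤-trans (≤-reflexive (+-comm 1 b)) b<k))))
    (trans (+-identityʳ (g (b + 0))) (cong g (+-identityʳ b)))

-- The semigroup generated by s, s + 1 and s + 2

Rep : ℕ → ℕ → Set
Rep s v = ∃[ k₁ ] ∃[ k₂ ] ∃[ k₃ ] (v ≡ k₁ * s + k₂ * (s + 1) + k₃ * (s + 2))

-- Sums of K generators fill the interval from K s to K (s + 2): take s + 2 while the excess d is at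
-- least 2, then at most one s + 1, then only s.
Rep-interval : ∀ s K d → d ≤ 2 * K → Rep s (K * s + d)
Rep-interval s zero    .0            z≤n = 0 , 0 , 0 , refl
Rep-interval s (suc K) zero          _   = suc K , 0 , 0 , lemma s K
  where
  lemma : ∀ s K → suc K * s + 0 ≡ suc K * s + 0 + 0
  lemma = solve-∀
Rep-interval s (suc K) (suc zero)    _   = K , 1 , 0 , lemma s K
  where
  lemma : ∀ s K → suc K * s + 1 ≡ K * s + 1 * (s + 1) + 0
  lemma = solve-∀
Rep-interval s (suc K) (suc (suc d)) le  with Rep-interval s K d (s≤s⁻¹ (s≤s⁻¹ (subst (suc (suc d) ≤_) (*-suc 2 K) le)))
... | k₁ , k₂ , k₃ , eq = k₁ , k₂ , suc k₃ , trans (lemma s K d) (trans (cong (_+ (s + 2)) eq) (lemma′ s k₁ k₂ k₃))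
  where
  lemma : ∀ s K d → suc K * s + suc (suc d) ≡ K * s + d + (s + 2)
  lemma = solve-∀
  lemma′ : ∀ s a b c → a * s + b * (s + 1) + c * (s + 2) + (s + 2) ≡ a * s + b * (s + 1) + suc c * (s + 2)
  lemma′ = solve-∀

Rep-+ : ∀ s {u v} → Rep s u → Rep s v → Rep s (u + v)
Rep-+ s (a , b , c , eq) (a′ , b′ , c′ , eq′) = a + a′ , b + b′ , c + c′ , trans (cong₂ _+_ eq eq′) (lemma s a b c a′ b′ c′)
  where
  lemma : ∀ s a b c a′ b′ c′ → a * s + b * (s + 1) + c * (s + 2) + (a′ * s + b′ * (s + 1) + c′ * (s + 2))
    ≡ (a + a′) * s + (b + b′) * (s + 1) + (c + c′) * (s + 2)
  lemma = solve-∀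

-- Rows of T (suc S): the row k is k (s + 2) + 1, ..., k (s + 2) + (S - 2 k), where s = suc S.
width : ℕ → ℕ
width S = 3 + S

val : ℕ → ℕ → ℕ → ℕ
val S k i = k * width S + suc i

rowLength : ℕ → ℕ → ℕ
rowLength S k = S ∸ 2 * k

<rowLength⇒ : ∀ {S k i} → i < rowLength S k → 2 * k + i < S
<rowLength⇒ {S} {k} {i} lt = ≤-trans (≤-reflexive (lemma k i)) (m≤o∸n⇒m+n≤o (suc i) (<⇒≤ (m∸n≢0⇒n<m (λ eq → n≮0 (subst (i <_) eq lt)))) lt)
  where
  lemma : ∀ k i → suc (2 * k + i) ≡ suc i + 2 * k
  lemma = solve-∀

-- Between the end of row k and the next multiple of s + 2, a number is (k + 1) s + d with d = 2 k +
-- i - S, small enough for k + 1 generators.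
Rep-outside : ∀ S k i → i < 2 + S → rowLength S k ≤ i → Rep (suc S) (val S k i)
Rep-outside S k i i<w N≤i = subst (Rep (suc S)) eq (Rep-interval (suc S) (suc k) d d≤)
  where
  S≤ : S ≤ 2 * k + i
  S≤ = ≤-trans (m≤n+m∸n S (2 * k)) (+-monoʳ-≤ (2 * k) N≤i)
  d : ℕ
  d = 2 * k + i ∸ S
  d+S≡ : d + S ≡ 2 * k + i
  d+S≡ = m∸n+n≡m S≤
  d≤ : d ≤ 2 * suc k
  d≤ = +-cancelʳ-≤ S d (2 * suc k) (≤-trans (≤-reflexive d+S≡)
    (≤-trans (+-monoʳ-≤ (2 * k) (≤-trans (n≤1+n i) i<w)) (≤-reflexive (lemma k S))))
    where
    lemma : ∀ k S → 2 * k + (2 + S) ≡ 2 * suc k + S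
    lemma = solve-∀
  eq : suc k * suc S + d ≡ val S k i
  eq = trans (lemma k S d) (trans (cong (λ x → k * S + k + 1 + x) d+S≡) (lemma′ k S i))
    where
    lemma : ∀ k S d → suc k * suc S + d ≡ k * S + k + 1 + (d + S)
    lemma = solve-∀
    lemma′ : ∀ k S i → k * S + k + 1 + (2 * k + i) ≡ k * (3 + S) + suc i
    lemma′ = solve-∀

Rep-multiple : ∀ S k → Rep (suc S) (k * width S + 0)
Rep-multiple S k = 0 , 0 , k , lemma k S
  where
  lemma : ∀ k S → k * (3 + S) + 0 ≡ k * (suc S + 2)
  lemma = solve-∀

-- At most k generators add up to at most k (s + 2), which is too small; more than k add up to at
-- least (k + 1) s, which is too large.
T-row : ∀ S k i → i < rowLength S k → T (suc S) (val S k i)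
T-row S k i i<N = subst (0 <_) (sym (+-suc (k * width S) i)) z<s , λ { (k₁ , k₂ , k₃ , eq) → no-rep k₁ k₂ k₃ eq }
  where
  no-rep : ∀ k₁ k₂ k₃ → val S k i ≢ k₁ * suc S + k₂ * (suc S + 1) + k₃ * (suc S + 2)
  no-rep k₁ k₂ k₃ eq with ≤-<-connex (k₁ + k₂ + k₃) k
  ... | inj₁ K≤k = <-irrefl refl (begin-strict
    val S k i                                               ≡⟨ eq ⟩
    k₁ * suc S + k₂ * (suc S + 1) + k₃ * (suc S + 2)        ≤⟨ m≤m+n _ (2 * k₁ + k₂) ⟩
    k₁ * suc S + k₂ * (suc S + 1) + k₃ * (suc S + 2) + (2 * k₁ + k₂)  ≡⟨ lemma S k₁ k₂ k₃ ⟩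
    (k₁ + k₂ + k₃) * width S                                ≤⟨ *-monoˡ-≤ (width S) K≤k ⟩
    k * width S                                             <⟨ m<m+n (k * width S) z<s ⟩
    val S k i ∎)
    where
    open ≤-Reasoning
    lemma : ∀ S a b c → a * suc S + b * (suc S + 1) + c * (suc S + 2) + (2 * a + b) ≡ (a + b + c) * (3 + S)
    lemma = solve-∀
  ... | inj₂ k<K = <-irrefl refl (begin-strict
    val S k i                                               ≡⟨ lemma k S i ⟩
    k * suc S + suc (2 * k + i)                             ≤⟨ +-monoʳ-≤ (k * suc S) (<rowLength⇒ {S} {k} i<N) ⟩
    k * suc S + S                                           <⟨ +-monoʳ-< (k * suc S) (n<1+n S) ⟩
    k * suc S + suc S                                       ≡⟨ +-comm (k * suc S) (suc S) ⟩
    suc k * suc S                                           ≤⟨ *-monoˡ-≤ (suc S) k<K ⟩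
    (k₁ + k₂ + k₃) * suc S                                  ≤⟨ m≤m+n _ (k₂ + 2 * k₃) ⟩
    (k₁ + k₂ + k₃) * suc S + (k₂ + 2 * k₃)                  ≡⟨ lemma′ S k₁ k₂ k₃ ⟩
    k₁ * suc S + k₂ * (suc S + 1) + k₃ * (suc S + 2)        ≡⟨ eq ⟨
    val S k i ∎)
    where
    open ≤-Reasoning
    lemma : ∀ k S i → k * (3 + S) + suc i ≡ k * suc S + suc (2 * k + i)
    lemma = solve-∀
    lemma′ : ∀ S a b c → (a + b + c) * suc S + (b + 2 * c) ≡ a * suc S + b * (suc S + 1) + c * (suc S + 2)
    lemma′ = solve-∀

-- Division by s + 2 gives the row and the position in it. This also decides T.
classify : ∀ S v → (∃[ k ] ∃[ i ] i < rowLength S k × v ≡ val S k i) ⊎ Rep (suc S) v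
classify S v = go (v % width S) (m%n<n v (width S)) (trans (m≡m%n+[m/n]*n v (width S)) (+-comm (v % width S) _))
  where
  k : ℕ
  k = v / width S
  go : ∀ r → r < width S → v ≡ k * width S + r → (∃[ k ] ∃[ i ] i < rowLength S k × v ≡ val S k i) ⊎ Rep (suc S) v
  go zero    _  eq = inj₂ (subst (Rep (suc S)) (sym eq) (Rep-multiple S k))
  go (suc i) lt eq with i <? rowLength S k
  ... | yes i<N = inj₁ (k , i , i<N , eq)
  ... | no  i≮N = inj₂ (subst (Rep (suc S)) (sym eq) (Rep-outside S k i (s<s⁻¹ lt) (≮⇒≥ i≮N)))

¬Rep⇒row : ∀ S {v} → ¬ Rep (suc S) v → ∃[ k ] ∃[ i ] i < rowLength S k × v ≡ val S k i
¬Rep⇒row S {v} ¬rep = [ (λ x → x) , (λ rep → contradiction rep ¬rep) ]′ (classify S v)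

T? : ∀ S v → Dec (T (suc S) v)
T? S v with classify S v
... | inj₁ (k , i , i<N , refl) = yes (T-row S k i i<N)
... | inj₂ rep                  = no (λ t → proj₂ t rep)

val< : ∀ S k i → i < rowLength S k → val S k i < suc S * width S
val< S k i i<N = begin-strict
  k * width S + suc i   <⟨ +-monoʳ-< (k * width S) (s≤s (s≤s (≤-trans (m+n≤o⇒n≤o (2 * k) (<⇒≤ lt)) (m≤n+m S 1)))) ⟩
  k * width S + width S ≡⟨ +-comm (k * width S) (width S) ⟩
  suc k * width S       ≤⟨ *-monoˡ-≤ (width S) (s≤s (≤-trans (m≤m+n k (k + 0)) (m+n≤o⇒m≤o (2 * k) (<⇒≤ lt)))) ⟩
  suc S * width S       ∎
  where
  open ≤-Reasoning
  lt : 2 * k + i < S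
  lt = <rowLength⇒ {S} {k} i<N

-- Filtering `downFrom` gives the strictly decreasing order that `fromBetaSet` needs; `val<` shows
-- that the bound is large enough.
T-list : ℕ → List ℕ
T-list S = filter (T? S) (downFrom (suc S * width S))

T-list-strict : ∀ S → AllPairs _>_ (T-list S)
T-list-strict S = AllPairs.filter⁺ (T? S) (AllPairs.applyDownFrom⁺₁ (λ i → i) (suc S * width S) (λ j<i _ → j<i))

T-list⁻ : ∀ S {v} → v ∈ T-list S → T (suc S) v
T-list⁻ S v∈ = proj₂ (∈-filter⁻ (T? S) {xs = downFrom (suc S * width S)} v∈)

T-list⁺ : ∀ S {v} → T (suc S) v → v ∈ T-list S
T-list⁺ S t with ¬Rep⇒row S (proj₂ t)
... | k , i , i<N , refl = ∈-filter⁺ (T? S) (∈-downFrom⁺ (val< S k i i<N)) t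

-- The complement of a β-set in T

module Complement (S : ℕ) (p : Partition) (¬rep : ∀ {v} → v ∈ betaSet p → ¬ Rep (suc S) v) where

  χ : ℕ → ℕ
  χ = occ (betaSet p)

  χ≤1 : ∀ v → χ v ≤ 1
  χ≤1 = occ≤1 (betaList-strict (decreasing⇒ p))

  N : ℕ → ℕ
  N = rowLength S

  y : ℕ → ℕ → ℕ
  y k i = 1 ∸ χ (val S k i)

  χ+y : ∀ k i → χ (val S k i) + y k i ≡ 1
  χ+y k i = m+[n∸m]≡n (χ≤1 (val S k i))

  r : ℕ → ℕ
  r k = ∑ (N k) (y k)

  R : ℕ
  R = ∑ (suc S) r

  ℓ : ℕ → ℕ
  ℓ k = ∑ (N k) (λ i → χ (val S k i))

  ℓ+r : ∀ k → ℓ k + r k ≡ N k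
  ℓ+r k = trans (sym (∑-+ (N k) _ _)) (trans (∑-cong (N k) (λ i _ → χ+y k i)) (∑-const (N k)))

  χ-Rep : ∀ {v} → Rep (suc S) v → χ v ≡ 0
  χ-Rep rep = occ-∉ (betaSet p) (λ v∈ → ¬rep v∈ rep)

  betaSet< : All (_< suc S * width S) (betaSet p)
  betaSet< = All.tabulate λ v∈ → bound (¬Rep⇒row S (¬rep v∈))
    where
    bound : ∀ {v} → ∃[ k ] ∃[ i ] i < rowLength S k × v ≡ val S k i → v < suc S * width S
    bound (k , i , i<N , refl) = val< S k i i<N

  -- Of the s + 2 numbers from k (s + 2) on, those outside row k are representable, so χ vanishes
  -- there.
  ∑-row : ∀ k (g : ℕ → ℕ) →
    ∑ (width S) (λ i → χ (k * width S + i) * g (k * width S + i)) ≡ ∑ (N k) (λ i → χ (val S k i) * g (val S k i))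
  ∑-row k g = begin
    h (k * width S + 0) + ∑ (2 + S) h′
      ≡⟨ cong (_+ ∑ (2 + S) h′) (cong (_* g (k * width S + 0)) (χ-Rep (Rep-multiple S k))) ⟩
    ∑ (2 + S) h′
      ≡⟨ cong (λ x → ∑ x h′) (sym (m+[n∸m]≡n N≤)) ⟩
    ∑ (N k + (2 + S ∸ N k)) h′
      ≡⟨ ∑-split (N k) (2 + S ∸ N k) h′ ⟩
    ∑ (N k) h′ + ∑ (2 + S ∸ N k) (λ i → h′ (N k + i))
      ≡⟨ cong (∑ (N k) h′ +_) (∑-zero (2 + S ∸ N k) (λ i i< → cong (_* g (val S k (N k + i)))
           (χ-Rep (Rep-outside S k (N k + i) (<-≤-trans (+-monoʳ-< (N k) i<) (≤-reflexive (m+[n∸m]≡n N≤))) (m≤m+n (N k) i))))) ⟩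
    ∑ (N k) h′ + 0
      ≡⟨ +-identityʳ _ ⟩
    ∑ (N k) h′ ∎
    where
    open ≡-Reasoning
    h h′ : ℕ → ℕ
    h v = χ v * g v
    h′ i = h (val S k i)
    N≤ : N k ≤ 2 + S
    N≤ = ≤-trans (m∸n≤m S (2 * k)) (m≤n+m S 2)

  -- T is the disjoint union of the β-set and Y. The weight 1 compares cardinalities, the identity
  -- compares sums.
  ∑-complement : ∀ (g : ℕ → ℕ) →
    sum (map g (betaSet p)) + ∑ (suc S) (λ k → ∑ (N k) (λ i → y k i * g (val S k i)))
      ≡ ∑ (suc S) (λ k → ∑ (N k) (λ i → g (val S k i)))
  ∑-complement g = begin
    sum (map g (betaSet p)) + ∑ (suc S) Y
      ≡⟨ cong (_+ ∑ (suc S) Y) (sym (∑-occ (suc S * width S) g betaSet<)) ⟩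
    ∑ (suc S * width S) (λ v → χ v * g v) + ∑ (suc S) Y
      ≡⟨ cong (_+ ∑ (suc S) Y) (trans (∑-rows (suc S) (width S) (λ v → χ v * g v)) (∑-cong (suc S) (λ k _ → ∑-row k g))) ⟩
    ∑ (suc S) (λ k → ∑ (N k) (λ i → χ (val S k i) * g (val S k i))) + ∑ (suc S) Y
      ≡⟨ sym (∑-+ (suc S) X Y) ⟩
    ∑ (suc S) (λ k → ∑ (N k) (λ i → χ (val S k i) * g (val S k i)) + Y k)
      ≡⟨ ∑-cong (suc S) (λ k _ → trans (sym (∑-+ (N k) (λ i → χ (val S k i) * g (val S k i)) (λ i → y k i * g (val S k i)))) (∑-cong (N k) (λ i _ →
           trans (sym (*-distribʳ-+ (g (val S k i)) (χ (val S k i)) (y k i)))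
             (trans (cong (_* g (val S k i)) (χ+y k i)) (*-identityˡ _))))) ⟩
    ∑ (suc S) (λ k → ∑ (N k) (λ i → g (val S k i))) ∎
    where
    open ≡-Reasoning
    X Y : ℕ → ℕ
    X k = ∑ (N k) (λ i → χ (val S k i) * g (val S k i))
    Y k = ∑ (N k) (λ i → y k i * g (val S k i))

  half≤ : half S ≤ suc S
  half≤ = ≤-trans (m≤m+n (half S) (half S + 0)) (≤-trans (m≤m+n _ (evenness S)) (≤-reflexive (2*half S)))

  length+R : length (parts p) + R ≡ area S
  length+R = begin
    length (parts p) + R
      ≡⟨ cong₂ _+_ (sym (trans (sum-map-1 (betaSet p)) (length-betaList (parts p))))
           (∑-cong (suc S) (λ k _ → ∑-cong (N k) (λ i _ → sym (*-identityʳ (y k i))))) ⟩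
    sum (map (λ _ → 1) (betaSet p)) + ∑ (suc S) (λ k → ∑ (N k) (λ i → y k i * 1))
      ≡⟨ ∑-complement (λ _ → 1) ⟩
    ∑ (suc S) (λ k → ∑ (N k) (λ _ → 1))
      ≡⟨ ∑-cong (suc S) (λ k _ → ∑-const (N k)) ⟩
    ∑ (suc S) N
      ≡⟨ ∑-staircase (suc S) S half≤ ⟩
    area S ∎
    where
    open ≡-Reasoning
    sum-map-1 : ∀ (bs : List ℕ) → sum (map (λ _ → 1) bs) ≡ length bs
    sum-map-1 []       = refl
    sum-map-1 (b ∷ bs) = cong suc (sum-map-1 bs)

  Yrow : ℕ → ℕ
  Yrow k = ∑ (N k) (λ i → y k i * val S k i)

  size+∑Y : size p + choose₂ (length (parts p)) + ∑ (suc S) Yrow ≡ ∑ (suc S) (λ k → ∑ (N k) (val S k))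
  size+∑Y = trans (cong (_+ ∑ (suc S) Yrow) (trans (sym (sum-betaList (parts p))) (cong sum (sym (map-id (betaSet p))))))
    (∑-complement (λ v → v))

  y≤1 : ∀ k i → y k i ≤ 1
  y≤1 k i = m∸n≤m 1 (χ (val S k i))

  Yrow≡ : ∀ k → Yrow k ≡ r k * (k * width S + 1) + ∑ (N k) (λ i → y k i * i)
  Yrow≡ k = trans (∑-cong (N k) (λ i _ → lemma (y k i) (k * width S) i))
    (trans (∑-+ (N k) _ _) (cong (_+ ∑ (N k) (λ i → y k i * i))
      (trans (∑-* (N k) (k * width S + 1) (y k)) (*-comm (k * width S + 1) (r k)))))
    where
    lemma : ∀ y a i → y * (a + suc i) ≡ (a + 1) * y + y * i
    lemma = solve-∀

  -- This is the push to the left within row k.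
  rowSum≤Yrow : ∀ k → rowSum (width S) 1 r k ≤ Yrow k
  rowSum≤Yrow k = ≤-trans (+-monoʳ-≤ (r k * (k * width S + 1)) (proj₂ (choose₂≤weighted-∑ (N k) (y k) (λ i _ → y≤1 k i))))
    (≤-reflexive (sym (Yrow≡ k)))

  ∈⇒y≡0 : ∀ {k i} → val S k i ∈ betaSet p → y k i ≡ 0
  ∈⇒y≡0 v∈ = m≤n⇒m∸n≡0 (occ-∈ v∈)

  y≡0⇒∈ : ∀ {k i} → y k i ≡ 0 → val S k i ∈ betaSet p
  y≡0⇒∈ {k} {i} eq = occ⇒∈ (betaSet p) (m∸n≡0⇒m≤n {1} eq)

  module _ (closed : ∀ {v} → v + suc S ∈ betaSet p → v ∈ betaSet p)
           (closed₁ : ∀ {v} → v + (suc S + 1) ∈ betaSet p → v ∈ betaSet p)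
           (closed₂ : ∀ {v} → v + (suc S + 2) ∈ betaSet p → v ∈ betaSet p) where

    -- Subtracting s + 2, s + 1 and s from position i of row k + 1 gives positions i, i + 1 and i +
    -- 2 of row k. By `dilation`, row k has at least two members more than a row k + 1 with members;
    -- being two longer, it misses no more. If row k + 1 has no members, all of it is missing.
    staircase : Staircase S r
    staircase .Staircase.bounded k = proj₁ (choose₂≤weighted-∑ (N k) (y k) (λ i _ → y≤1 k i))
    staircase .Staircase.rising k zero    _     _     = z≤n
    staircase .Staircase.rising k (suc j) j<rₖ j<N
      with dilation (N (suc k)) (λ i → χ (val S (suc k) i)) (λ i → χ (val S k i)) (λ i _ → χ≤1 _) below
      where
      below : ∀ i → i < N (suc k) → 1 ≤ χ (val S (suc k) i) →
        1 ≤ χ (val S k i) × 1 ≤ χ (val S k (1 + i)) × 1 ≤ χ (val S k (2 + i))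
      below i _ pos = occ-∈ (closed₂ (subst (_∈ betaSet p) (lemma₂ S k i) v∈))
                    , occ-∈ (closed₁ (subst (_∈ betaSet p) (lemma₁ S k i) v∈))
                    , occ-∈ (closed (subst (_∈ betaSet p) (lemma₀ S k i) v∈))
        where
        v∈ : val S (suc k) i ∈ betaSet p
        v∈ = occ⇒∈ (betaSet p) pos
        lemma₂ : ∀ S k i → suc k * (3 + S) + suc i ≡ k * (3 + S) + suc i + (suc S + 2)
        lemma₂ = solve-∀
        lemma₁ : ∀ S k i → suc k * (3 + S) + suc i ≡ k * (3 + S) + suc (1 + i) + (suc S + 1)
        lemma₁ = solve-∀
        lemma₀ : ∀ S k i → suc k * (3 + S) + suc i ≡ k * (3 + S) + suc (2 + i) + suc S
        lemma₀ = solve-∀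
    ... | inj₁ ℓ≡0 = ≤-trans j<N (≤-reflexive (trans (sym (ℓ+r (suc k))) (cong (_+ r (suc k)) ℓ≡0)))
    ... | inj₂ le = ≤-trans j<rₖ (+-cancelˡ-≤ (2 + ℓ (suc k)) (r k) (r (suc k)) (begin
      2 + ℓ (suc k) + r k                                ≤⟨ +-monoˡ-≤ (r k) le ⟩
      ∑ (2 + N (suc k)) (λ i → χ (val S k i)) + r k      ≡⟨ cong (λ x → ∑ x (λ i → χ (val S k i)) + r k) (sym Nₖ) ⟩
      ℓ k + r k                                          ≡⟨ ℓ+r k ⟩
      N k                                                ≡⟨ Nₖ ⟩
      2 + N (suc k)                                      ≡⟨ cong (2 +_) (sym (ℓ+r (suc k))) ⟩
      2 + ℓ (suc k) + r (suc k)                          ∎))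
      where
      open ≤-Reasoning
      -- Row k + 1 is nonempty since j < `N (suc k)`, so neither length is truncated.
      Nₖ : N k ≡ 2 + N (suc k)
      Nₖ = sym (trans (sym (+-∸-assoc 2 2k+2≤S)) (cong (2 + S ∸_) (*-suc 2 k)))
        where
        2k+2≤S : 2 * suc k ≤ S
        2k+2≤S = <⇒≤ (m∸n≢0⇒n<m (λ eq → n≮0 (subst (suc j ≤_) eq j<N)))

    c*R≤ : area S * R ≤ total (width S) 1 (suc S) r
    c*R≤ = subst (λ x → area S * R ≤ total x 1 (suc S) r) (+-comm S 3) (proj₁ (staircase-bound (suc S) S r half≤ staircase))

    total≤ : total (width S) 1 (suc S) r ≤ ∑ (suc S) Yrow + choose₂ (suc R)
    total≤ = +-monoˡ-≤ (choose₂ (suc R)) (∑-mono (suc S) (λ k _ → rowSum≤Yrow k))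

    -- Equality holds both in `staircase-bound` and in the push to the left. The first fixes the row
    -- counts, the second the positions.
    extremal : ∑ (suc S) Yrow + choose₂ (suc R) ≤ area S * R →
      (∀ k i → i < N k → y k i ≡ 0) ⊎ (evenness S ≡ 1 × (∀ k i → i < N k → y k i ≡ δ 0 i))
    extremal le with proj₂ (staircase-bound (suc S) S r half≤ staircase)
      (subst (λ x → total x 1 (suc S) r ≤ area S * R) (+-comm 3 S) (≤-trans total≤ le))
    ... | inj₁ R≡0 = inj₁ (λ k i i<N → ∑≡0⇒≡0 (N k) {y k} (∑≡0⇒≡0 (suc S) {r} R≡0 k (row< {k} i<N)) i i<N)
      where
      row< : ∀ {k i} → i < N k → k < suc S
      row< {k} i<N = s≤s (≤-trans (m≤m+n k (k + 0)) (m+n≤o⇒m≤o (2 * k) (<⇒≤ (<rowLength⇒ {S} {k} i<N))))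
    ... | inj₂ (odd , r≡1) = inj₂ (odd , first)
      where
      k<half : ∀ {k i} → i < N k → k < half S
      k<half {k} {i} i<N = ≰⇒> (λ e≤k → n≮0 (subst (i <_) (≥half⇒staircase≡0 {S} e≤k) i<N))
      tight : ∀ k → k < suc S → rowSum (width S) 1 r k ≡ Yrow k
      tight = ∑-mono-tight (suc S) (λ k _ → rowSum≤Yrow k)
        (+-cancelʳ-≤ (choose₂ (suc R)) _ _ (≤-trans le c*R≤))
      -- One missing element per row and `choose₂ 1` = 0 leave index sum 0, so the missing element
      -- is the first of its row.
      weighted≡0 : ∀ k → k < half S → ∑ (N k) (λ i → y k i * i) ≡ 0
      weighted≡0 k k<e = sym (trans (cong choose₂ {1} {r k} (sym (r≡1 k k<e)))
        (+-cancelˡ-≡ (r k * (k * width S + 1)) _ _ (trans (tight k (<-≤-trans k<e half≤)) (Yrow≡ k))))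
      tail≡0 : ∀ k i → suc i < N k → y k (suc i) ≡ 0
      tail≡0 k i i<N = m*n≡0⇒m≡0 (y k (suc i)) (suc i)
        (∑≡0⇒≡0 (N k) {λ i → y k i * i} (weighted≡0 k (k<half {k} i<N)) (suc i) i<N)
      head≡1 : ∀ k n → n ≡ N k → 0 < n → ∑ n (y k) ≡ 1 → y k 0 ≡ 1
      head≡1 k (suc n) eq _ sum≡1 = trans (sym (+-identityʳ (y k 0))) (trans
        (cong (y k 0 +_) (sym (∑-zero n (λ i i<n → tail≡0 k i (subst (suc i <_) eq (s<s i<n)))))) sum≡1)
      first : ∀ k i → i < N k → y k i ≡ δ 0 i
      first k zero    i<N = head≡1 k (N k) refl i<N (r≡1 k (k<half {k} i<N))
      first k (suc i) i<N = tail≡0 k i i<N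

-- Comparison with κ

≐-unique : ∀ {P : ℕ → Set} p q → β p ≐ P → β q ≐ P → p ≡ q
≐-unique p q (p⊆ , ⊆p) (q⊆ , ⊆q) = betaSet-injective p q
  (λ v∈ → β⇒∈ q (⊆q (p⊆ (∈⇒β p v∈)))) (λ v∈ → β⇒∈ p (⊆p (q⊆ (∈⇒β q v∈))))

κ-exists : ∀ S → ∃! _≡_ (λ κ → β κ ≐ T (suc S))
κ-exists S = κ , β≐T , λ {q} β≐ → ≐-unique κ q β≐T β≐
  where
  positive-list : All (0 <_) (T-list S)
  positive-list = All.tabulate (λ v∈ → proj₁ (T-list⁻ S v∈))
  κ : Partition
  κ = fromBetaSet (T-list-strict S) positive-list
  eq : betaSet κ ≡ T-list S
  eq = betaList-fromBeta (T-list-strict S) positive-list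
  β≐T : β κ ≐ T (suc S)
  β≐T = (λ b → T-list⁻ S (subst (_ ∈_) eq (β⇒∈ κ b))) , (λ t → ∈⇒β κ (subst (_ ∈_) (sym eq) (T-list⁺ S t)))

-- Removing the generators of a representation one by one would lead down to 0, which is never a
-- β-number.
tripleCore⇒¬Rep : ∀ s p → IsTripleCore s p → ∀ {v} → v ∈ betaSet p → ¬ Rep s v
tripleCore⇒¬Rep s p (core₀ , core₁ , core₂) v∈ (a , b , c , refl) =
  0∉betaSet p (descend core₀ a (descend core₁ b (descend core₂ c v∈)))
  where
  descend : ∀ {t} → IsCore t p → ∀ k {v} → v + k * t ∈ betaSet p → v ∈ betaSet p
  descend core zero    {v} v∈ = subst (_∈ betaSet p) (+-identityʳ v) v∈
  descend {t} core (suc k) {v} v∈ =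
    core⇒closed p core (descend core k (subst (_∈ betaSet p) (sym (+-assoc v t (k * t))) v∈))

IsTripleCore-conjugate : ∀ {s} p → IsTripleCore s p → IsTripleCore s (conjugate p)
IsTripleCore-conjugate p (core₀ , core₁ , core₂) =
  IsCore-conjugate p core₀ , IsCore-conjugate p core₁ , IsCore-conjugate p core₂

-- Representable numbers are closed under addition, so if v + t is not representable for a generator
-- t, neither is v; and v is not 0 because t is representable.
T⇒tripleCore : ∀ s κ → β κ ≐ T s → IsTripleCore s κ
T⇒tripleCore s κ (β⊆T , T⊆β) =
    core s (1 , 0 , 0 , lemma₀ s) , core (s + 1) (0 , 1 , 0 , lemma₁ s) , core (s + 2) (0 , 0 , 1 , lemma₂ s)
  where
  lemma₀ : ∀ s → s ≡ 1 * s + 0 * (s + 1) + 0 * (s + 2)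
  lemma₀ = solve-∀
  lemma₁ : ∀ s → s + 1 ≡ 0 * s + 1 * (s + 1) + 0 * (s + 2)
  lemma₁ = solve-∀
  lemma₂ : ∀ s → s + 2 ≡ 0 * s + 0 * (s + 1) + 1 * (s + 2)
  lemma₂ = solve-∀
  core : ∀ t → Rep s t → IsCore t κ
  core t rep = closed⇒core κ closed
    where
    closed : ∀ {v} → v + t ∈ betaSet κ → v ∈ betaSet κ
    closed {v} v+t∈ = β⇒∈ κ (T⊆β (positive′ v ¬rep , λ repᵥ → ¬rep (Rep-+ s repᵥ rep)))
      where
      ¬rep : ¬ Rep s (v + t)
      ¬rep = proj₂ (β⊆T (∈⇒β κ v+t∈))
      positive′ : ∀ v → ¬ Rep s (v + t) → 0 < v
      positive′ zero    ¬rep = contradiction rep ¬rep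
      positive′ (suc _) _    = z<s

module _ (S : ℕ) (κ : Partition) (κ≐T : β κ ≐ T (suc S)) where

  κ⊆ : ∀ {v} → v ∈ betaSet κ → ¬ Rep (suc S) v
  κ⊆ v∈ = proj₂ (proj₁ κ≐T (∈⇒β κ v∈))

  module K = Complement S κ κ⊆

  K-y≡0 : ∀ k i → i < rowLength S k → K.y k i ≡ 0
  K-y≡0 k i i<N = K.∈⇒y≡0 {k} {i} (β⇒∈ κ (proj₂ κ≐T (T-row S k i i<N)))

  length-κ : length (parts κ) ≡ area S
  length-κ = trans (sym (+-identityʳ _)) (trans
    (cong (length (parts κ) +_) (sym (∑-zero (suc S) (λ k _ → ∑-zero (rowLength S k) (K-y≡0 k))))) K.length+R)

  size-κ : size κ + choose₂ (area S) ≡ ∑ (suc S) (λ k → ∑ (rowLength S k) (val S k))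
  size-κ = trans (sym (+-identityʳ _)) (trans (cong₂ _+_ (cong (λ x → size κ + choose₂ x) (sym length-κ))
    (sym (∑-zero (suc S) (λ k _ → ∑-zero (rowLength S k) (λ i i<N → cong (_* val S k i) (K-y≡0 k i i<N)))))) K.size+∑Y)

  module Compare (p : Partition) (core : IsTripleCore (suc S) p) where

    module P = Complement S p (tripleCore⇒¬Rep (suc S) p core)

    n R ∑Y c : ℕ
    n = length (parts p)
    R = P.R
    ∑Y = ∑ (suc S) P.Yrow
    c = area S

    -- size κ - size p = ∑Y - c R + R (R + 1) / 2, with the subtractions moved across.
    balance : size p + (∑Y + choose₂ (suc R)) ≡ size κ + c * R
    balance = +-cancelʳ-≡ (choose₂ n) _ _ (begin
      size p + (∑Y + choose₂ (suc R)) + choose₂ n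
        ≡⟨ lemma₁ (size p) ∑Y (choose₂ (suc R)) (choose₂ n) ⟩
      size p + choose₂ n + ∑Y + choose₂ (suc R)
        ≡⟨ cong (_+ choose₂ (suc R)) (trans P.size+∑Y (sym size-κ)) ⟩
      size κ + choose₂ c + choose₂ (suc R)
        ≡⟨ cong (λ x → size κ + choose₂ x + choose₂ (suc R)) (sym P.length+R) ⟩
      size κ + choose₂ (n + R) + choose₂ (suc R)
        ≡⟨ cong (λ x → size κ + x + choose₂ (suc R)) (choose₂-+ n R) ⟩
      size κ + (choose₂ n + n * R + choose₂ R) + (R + choose₂ R)
        ≡⟨ lemma₂ (size κ) (choose₂ n) (n * R) R (choose₂ R) ⟩
      size κ + choose₂ n + n * R + (2 * (choose₂ R) + R)
        ≡⟨ cong (λ x → size κ + choose₂ n + n * R + x) (square R) ⟩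
      size κ + choose₂ n + n * R + R * R
        ≡⟨ lemma₃ (size κ) (choose₂ n) n R ⟩
      size κ + (n + R) * R + choose₂ n
        ≡⟨ cong (λ x → size κ + x * R + choose₂ n) P.length+R ⟩
      size κ + c * R + choose₂ n ∎)
      where
      open ≡-Reasoning
      lemma₁ : ∀ a b c d → a + (b + c) + d ≡ a + d + b + c
      lemma₁ = solve-∀
      lemma₂ : ∀ a b c d e → a + (b + c + e) + (d + e) ≡ a + b + c + (2 * e + d)
      lemma₂ = solve-∀
      lemma₃ : ∀ a b n R → a + b + n * R + R * R ≡ a + (n + R) * R + b
      lemma₃ = solve-∀
      square : ∀ R → 2 * choose₂ R + R ≡ R * R
      square zero    = refl
      square (suc R) = trans (cong (_+ suc R) (2*choose₂-suc R)) (lemma R)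
        where
        lemma : ∀ R → R * suc R + suc R ≡ suc R * suc R
        lemma = solve-∀

    closed₀ : ∀ {v} → v + suc S ∈ betaSet p → v ∈ betaSet p
    closed₀ = core⇒closed p (proj₁ core)
    closed₁ : ∀ {v} → v + (suc S + 1) ∈ betaSet p → v ∈ betaSet p
    closed₁ = core⇒closed p (proj₁ (proj₂ core))
    closed₂ : ∀ {v} → v + (suc S + 2) ∈ betaSet p → v ∈ betaSet p
    closed₂ = core⇒closed p (proj₂ (proj₂ core))

    size≤ : size p ≤ size κ
    size≤ = +-cancelʳ-≤ (c * R) (size p) (size κ) (≤-trans
      (+-monoʳ-≤ (size p) (≤-trans (P.c*R≤ closed₀ closed₁ closed₂) (P.total≤ closed₀ closed₁ closed₂)))
      (≤-reflexive balance))

    size≡ : size κ ≤ size p →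
      (∀ k i → i < rowLength S k → P.y k i ≡ 0) ⊎ (evenness S ≡ 1 × (∀ k i → i < rowLength S k → P.y k i ≡ δ 0 i))
    size≡ le = P.extremal closed₀ closed₁ closed₂ (+-cancelˡ-≤ (size p) _ _
      (≤-trans (≤-reflexive balance) (+-monoˡ-≤ (c * R) le)))

  κ-max : IsMaxTripleCore (suc S) κ
  κ-max = T⇒tripleCore (suc S) κ κ≐T , λ p core → Compare.size≤ p core

  conjugate-max : IsMaxTripleCore (suc S) (conjugate κ)
  conjugate-max = IsTripleCore-conjugate κ (proj₁ κ-max) ,
    λ p core → ≤-trans (Compare.size≤ p core) (≤-reflexive (sym (size-conjugate κ)))

  same-complement : ∀ p q (cp : IsTripleCore (suc S) p) (cq : IsTripleCore (suc S) q) →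
    (∀ k i → i < rowLength S k → Compare.P.y p cp k i ≡ Compare.P.y q cq k i) → p ≡ q
  same-complement p q cp cq eq = betaSet-injective p q
    (λ v∈ → include p q cp cq eq v∈) (λ v∈ → include q p cq cp (λ k i i<N → sym (eq k i i<N)) v∈)
    where
    include : ∀ p q (cp : IsTripleCore (suc S) p) (cq : IsTripleCore (suc S) q) →
      (∀ k i → i < rowLength S k → Compare.P.y p cp k i ≡ Compare.P.y q cq k i) →
      ∀ {v} → v ∈ betaSet p → v ∈ betaSet q
    include p q cp cq eq v∈ with ¬Rep⇒row S (tripleCore⇒¬Rep (suc S) p cp v∈)
    ... | k , i , i<N , refl = Compare.P.y≡0⇒∈ q cq {k} {i} (trans (sym (eq k i i<N)) (Compare.P.∈⇒y≡0 p cp {k} {i} v∈))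

  FirstColumn : ∀ μ → IsTripleCore (suc S) μ → Set
  FirstColumn μ cμ = evenness S ≡ 1 × (∀ k i → i < rowLength S k → Compare.P.y μ cμ k i ≡ δ 0 i)

  max-cases : ∀ μ (μ-max : IsMaxTripleCore (suc S) μ) → μ ≡ κ ⊎ FirstColumn μ (proj₁ μ-max)
  max-cases μ (cμ , maxμ) = Sum.map₁
    (λ y≡0 → same-complement μ κ cμ (proj₁ κ-max) (λ k i i<N → trans (y≡0 k i i<N) (sym (K-y≡0 k i i<N))))
    (Compare.size≡ μ cμ (maxμ κ (proj₁ κ-max)))

  -- Any two maximal cores other than κ miss exactly the first column and so coincide. Taking the
  -- conjugate of κ for ν avoids constructing this second core from its β-set.
  max-dichotomy : ∀ μ ν → IsMaxTripleCore (suc S) μ → IsMaxTripleCore (suc S) ν → ν ≢ κ → μ ≡ κ ⊎ μ ≡ ν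
  max-dichotomy μ ν μ-max ν-max ν≢κ = Sum.map₂
    (λ (_ , yμ) → [ (λ ν≡κ → contradiction ν≡κ ν≢κ)
                  , (λ (_ , yν) → same-complement μ ν (proj₁ μ-max) (proj₁ ν-max)
                      (λ k i i<N → trans (yμ k i i<N) (sym (yν k i i<N)))) ]′ (max-cases ν ν-max))
    (max-cases μ μ-max)

  -- A missing first column requires `evenness S` = 1, which makes s = 2 `half S` + 1 odd.
  unique-even : 2 ∣ suc S → ∀ μ → IsMaxTripleCore (suc S) μ → μ ≡ κ
  unique-even (divides d eq) μ μ-max =
    [ (λ μ≡κ → μ≡κ) , (λ (odd , _) → contradiction (d*2≡ odd) (even≢odd d (half S))) ]′ (max-cases μ μ-max)
    where
    d*2≡ : evenness S ≡ 1 → 2 * d ≡ suc (2 * half S)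
    d*2≡ odd = trans (*-comm 2 d) (trans (sym eq) (trans (sym (2*half S))
      (trans (cong (2 * half S +_) odd) (+-comm (2 * half S) 1))))

  -- A self-conjugate κ has the largest hook 2 |T| - 1, but this number is a sum of generators.
  κ≢conjugate : 2 ≤ S → 2 ∤ suc S → κ ≢ conjugate κ
  κ≢conjugate 2≤S ¬even κ≡ = go (half S) refl
    where
    odd : evenness S ≡ 1
    odd with evenness-cases S
    ... | inj₂ eq = eq
    ... | inj₁ eq = contradiction (divides (half S) (trans (sym (2*half S))
          (trans (cong (2 * half S +_) eq) (trans (+-identityʳ _) (*-comm 2 (half S)))))) ¬even
    s≡ : 2 * half S + 1 ≡ suc S
    s≡ = trans (cong (2 * half S +_) (sym odd)) (2*half S)
    row₀ : row κ 0 ≡ area S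
    row₀ = trans (cong (λ p → row p 0) κ≡) (trans (row-conjugate κ 0) (trans (countAbove-0 (positive κ)) length-κ))
    go : ∀ h → half S ≢ h
    go zero    eq = contradiction (trans (cong (λ x → 2 * x + 1) (sym eq)) s≡) (λ { refl → n≮0 2≤S })
    -- With `half S` = a + 1, s = 2 a + 3 and |T| = (a + 1)(a + 2), so 2 |T| - 1 = (a + 1) s + a,
    -- which a + 1 generators represent.
    go (suc a) eq = κ⊆ (β⇒∈ κ (0 , box , hook≡)) 
        (Rep-interval (suc S) (suc a) a (≤-trans (n≤1+n a) (m≤m+n (suc a) _)))
      where
      area≡ : area S ≡ suc a * (suc a + 1)
      area≡ = cong₂ (λ x y → x * (x + y)) eq odd
      box : Box κ 0 0
      box = subst (0 <_) (sym (trans row₀ area≡)) z<s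
      hook≡ : hook κ 0 0 ≡ suc a * suc S + a
      hook≡ = +-cancelʳ-≡ 1 _ _ (begin
        hook κ 0 0 + 1                                ≡⟨ firstHook κ 0 box ⟩
        row κ 0 + length (parts κ)                    ≡⟨ cong₂ _+_ (trans row₀ area≡) (trans length-κ area≡) ⟩
        suc a * (suc a + 1) + suc a * (suc a + 1)     ≡⟨ lemma a ⟩
        suc a * (2 * suc a + 1) + a + 1               ≡⟨ cong (λ x → suc a * (2 * x + 1) + a + 1) (sym eq) ⟩
        suc a * (2 * half S + 1) + a + 1              ≡⟨ cong (λ x → suc a * x + a + 1) s≡ ⟩
        suc a * suc S + a + 1                         ∎)
        where
        open ≡-Reasoning
        lemma : ∀ a → suc a * (suc a + 1) + suc a * (suc a + 1) ≡ suc a * (2 * suc a + 1) + a + 1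
        lemma = solve-∀

theorem3p4 : (s : ℕ) → 3 ≤ s →
    ∃! _≡_ (λ κ → β κ ≐ T s) ×
    ((κ : Partition) → β κ ≐ T s →
    IsMaxTripleCore s κ ×
    (2 ∣ s →
    ((μ : Partition) → IsMaxTripleCore s μ → μ ≡ κ) ×
    conjugate κ ≡ κ) ×
    (2 ∤ s →
    κ ≢ conjugate κ ×
    ((μ : Partition) → IsMaxTripleCore s μ ⇔ (μ ≡ κ ⊎ μ ≡ conjugate κ))))
theorem3p4 (suc S) (s≤s 2≤S) = κ-exists S , λ κ κ≐T →
    κ-max S κ κ≐T
  -- The conjugate is also maximal, so uniqueness makes κ self-conjugate.
  , (λ even → unique-even S κ κ≐T even , unique-even S κ κ≐T even (conjugate κ) (conjugate-max S κ κ≐T))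
  , (λ odd → let κ≢ = κ≢conjugate S κ κ≐T 2≤S odd in κ≢ , λ μ → mk⇔
      (λ μ-max → max-dichotomy S κ κ≐T μ (conjugate κ) μ-max (conjugate-max S κ κ≐T) (λ eq → κ≢ (sym eq)))
      (λ { (inj₁ refl) → κ-max S κ κ≐T ; (inj₂ refl) → conjugate-max S κ κ≐T }))
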